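{- Let $q,b$ be complex numbers with $|q|<1$ and $b\neq -q^{ -N}$ for any positive integer $N$. Then for all positive integers $m$ and $n$, $$\sum_{0\leq a_1\leq a_2\leq \dots \leq a_n}\frac{q^{m(a_1+a_2+\dots +a_n)}}{\prod_{j=0}^{n-1}\prod_{k=1}^{m+1}\left(1+bq^{j(m+1)+k+a_{j+1}}\right)}=\frac{1}{(q^m;q^m)_n\,(-bq;q)_{mn}},$$ where the sum is over all $n$-tuples $(a_1,\dots,a_n)$ of integers satisfying $0\leq a_1\leq a_2\leq\dots\leq a_n$.
   Context: Notation: $(x;q)_0=1$ and $(x;q)_n=\prod_{j=0}^{n-1}(1-xq^{j})$ for $n\ge 1$; thus $(q^m;q^m)_n=\prod_{j=1}^{n}(1-q^{mj})$ and $(-bq;q)_{mn}=\prod_{j=1}^{mn}(1+bq^{j})$. The condition $b\ne -q^{ -N}$ means $1+bq^N\neq 0$. -}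

module Defs where

open import Algebra.Bundles.Raw using (RawSemiring)
import Algebra.Definitions.RawSemiring as RawSemiringDefs
open import Data.Fin.Base as Fin using (Fin; toℕ)
open import Data.List.Base as List using (List)
open import Data.List.Relation.Binary.Subset.Propositional using (_⊆_)
open import Data.List.Relation.Unary.Unique.Propositional using (Unique)
open import Data.Nat.Base as ℕ using (ℕ; zero; suc)
import Data.Nat.Properties as ℕ
open import Data.Product.Base using (Σ-syntax; ∃-syntax; _×_; _,_; proj₁; proj₂)
open import Data.Rational.Base as ℚ using (ℚ; 0ℚ; 1ℚ; ½)
import Data.Rational.Properties as ℚ
open import Data.Rational.Solver using (module +-*-Solver)
open import Data.Sum.Base using (inj₁; inj₂)
open import Data.Vec.Base as Vec using (Vec)
open import Data.Vec.Relation.Unary.Linked using (Linked)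
open import Level using (0ℓ)
open import Relation.Binary.PropositionalEquality
  using (_≡_; refl; sym; trans; cong; cong₂; subst)
open import Relation.Nullary using (yes; no; contradiction)

open +-*-Solver using (solve; _:=_; _:+_; _:*_; _:-_; :-_; con)

------------------------------------------------------------------------
-- Auxiliary facts about ℚ

private
  0<1 : 0ℚ ℚ.< 1ℚ
  0<1 = ℚ.positive⁻¹ 1ℚ

  0<½ : 0ℚ ℚ.< ½
  0<½ = ℚ.positive⁻¹ ½

  *-pos : ∀ {p q} → 0ℚ ℚ.< p → 0ℚ ℚ.< q → 0ℚ ℚ.< p ℚ.* q
  *-pos {p} {q} 0<p 0<q = ℚ.positive⁻¹ (p ℚ.* q)
    {{ℚ.pos*pos⇒pos p {{ℚ.positive 0<p}} q {{ℚ.positive 0<q}}}}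

  +-pos : ∀ {p q} → 0ℚ ℚ.≤ p → 0ℚ ℚ.< q → 0ℚ ℚ.< p ℚ.+ q
  +-pos 0≤p 0<q = ℚ.+-mono-≤-< 0≤p 0<q

  *-monoˡ : ∀ {p q r} → 0ℚ ℚ.≤ p → q ℚ.≤ r → p ℚ.* q ℚ.≤ p ℚ.* r
  *-monoˡ {p} 0≤p = ℚ.*-monoˡ-≤-nonNeg p {{ℚ.nonNegative 0≤p}}

  *-monoʳ : ∀ {p q r} → 0ℚ ℚ.≤ p → q ℚ.≤ r → q ℚ.* p ℚ.≤ r ℚ.* p
  *-monoʳ {p} 0≤p = ℚ.*-monoʳ-≤-nonNeg p {{ℚ.nonNegative 0≤p}}

  *-mono : ∀ {p q r s} → 0ℚ ℚ.≤ q → 0ℚ ℚ.≤ r → p ℚ.≤ r → q ℚ.≤ s →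
           p ℚ.* q ℚ.≤ r ℚ.* s
  *-mono 0≤q 0≤r p≤r q≤s = ℚ.≤-trans (*-monoʳ 0≤q p≤r) (*-monoˡ 0≤r q≤s)

  square-nonNeg : ∀ p → 0ℚ ℚ.≤ p ℚ.* p
  square-nonNeg p with ℚ.≤-total 0ℚ p
  ... | inj₁ 0≤p = subst (ℚ._≤ p ℚ.* p) (ℚ.*-zeroʳ p) (*-monoˡ 0≤p 0≤p)
  ... | inj₂ p≤0 = subst (ℚ._≤ p ℚ.* p) (ℚ.*-zeroʳ p)
                     (ℚ.*-monoˡ-≤-nonPos p {{ℚ.nonPositive p≤0}} p≤0)

  half-pos : ∀ {ε} → 0ℚ ℚ.< ε → 0ℚ ℚ.< ½ ℚ.* ε
  half-pos = *-pos 0<½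

  half+half : ∀ ε → ½ ℚ.* ε ℚ.+ ½ ℚ.* ε ≡ ε
  half+half = solve 1 (λ ε → con ½ :* ε :+ con ½ :* ε := ε) refl

inv : ℚ → ℚ
inv p with p ℚ.≟ 0ℚ
... | yes _  = 0ℚ
... | no p≢0 = (ℚ.1/ p) {{ℚ.≢-nonZero p≢0}}

private
  *-inv : ∀ {p} → 0ℚ ℚ.< p → p ℚ.* inv p ≡ 1ℚ
  *-inv {p} 0<p with p ℚ.≟ 0ℚ
  ... | yes p≡0 = contradiction (sym p≡0) (ℚ.<⇒≢ 0<p)
  ... | no  p≢0 = ℚ.*-inverseʳ p {{ℚ.≢-nonZero p≢0}}

  inv-pos : ∀ {p} → 0ℚ ℚ.< p → 0ℚ ℚ.< inv p
  inv-pos {p} 0<p = ℚ.*-cancelˡ-<-nonNeg p {{ℚ.nonNegative (ℚ.<⇒≤ 0<p)}}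
    (subst (ℚ._< p ℚ.* inv p) (sym (ℚ.*-zeroʳ p))
      (subst (0ℚ ℚ.<_) (sym (*-inv 0<p)) 0<1))

------------------------------------------------------------------------
-- Real numbers, as Cauchy sequences of rationals

IsCauchy : (ℕ → ℚ) → Set
IsCauchy x = ∀ ε → 0ℚ ℚ.< ε →
  ∃[ N ] (∀ m n → N ℕ.≤ m → N ℕ.≤ n → ℚ.∣ x m ℚ.- x n ∣ ℚ.< ε)

record ℝ : Set where
  constructor mkℝ
  field
    seq    : ℕ → ℚ
    cauchy : IsCauchy seq

open ℝ public

infix 4 _≃ᴿ_ _<ᴿ_

_≃ᴿ_ : ℝ → ℝ → Set
x ≃ᴿ y = ∀ ε → 0ℚ ℚ.< ε →
  ∃[ N ] (∀ n → N ℕ.≤ n → ℚ.∣ seq x n ℚ.- seq y n ∣ ℚ.< ε)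

_<ᴿ_ : ℝ → ℝ → Set
x <ᴿ y = Σ[ δ ∈ ℚ ] 0ℚ ℚ.< δ ×
  ∃[ N ] (∀ n → N ℕ.≤ n → seq x n ℚ.+ δ ℚ.≤ seq y n)

fromℚ : ℚ → ℝ
fromℚ p = mkℝ (λ _ → p) λ ε 0<ε → 0 , λ _ _ _ _ →
  subst (ℚ._< ε) (sym (cong ℚ.∣_∣ (ℚ.+-inverseʳ p))) 0<ε

0ℝ 1ℝ : ℝ
0ℝ = fromℚ 0ℚ
1ℝ = fromℚ 1ℚ

private
  abstract
    +-cauchy : ∀ {x y} → IsCauchy x → IsCauchy y → IsCauchy (λ n → x n ℚ.+ y n)
    +-cauchy {x} {y} cx cy ε 0<ε
      with cx (½ ℚ.* ε) (half-pos 0<ε) | cy (½ ℚ.* ε) (half-pos 0<ε)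
    ... | M , hM | N , hN = M ℕ.⊔ N , λ m n m≥ n≥ →
      subst (ℚ._< ε)
        (cong ℚ.∣_∣ (rearrange (x m) (x n) (y m) (y n)))
        (ℚ.≤-<-trans (ℚ.∣p+q∣≤∣p∣+∣q∣ (x m ℚ.- x n) (y m ℚ.- y n))
          (subst (_ ℚ.<_) (half+half ε)
            (ℚ.+-mono-< (hM m n (ℕ.m⊔n≤o⇒m≤o M N m≥) (ℕ.m⊔n≤o⇒m≤o M N n≥))
                        (hN m n (ℕ.m⊔n≤o⇒n≤o M N m≥) (ℕ.m⊔n≤o⇒n≤o M N n≥)))))
      where
      rearrange : ∀ a b c d → (a ℚ.- b) ℚ.+ (c ℚ.- d) ≡ (a ℚ.+ c) ℚ.- (b ℚ.+ d)
      rearrange = solve 4 (λ a b c d →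
        (a :- b) :+ (c :- d) := (a :+ c) :- (b :+ d)) refl

    neg-cauchy : ∀ {x} → IsCauchy x → IsCauchy (λ n → ℚ.- x n)
    neg-cauchy {x} cx ε 0<ε with cx ε 0<ε
    ... | N , hN = N , λ m n m≥ n≥ →
      subst (ℚ._< ε)
        (trans (sym (ℚ.∣-p∣≡∣p∣ _)) (cong ℚ.∣_∣ (rearrange (x m) (x n))))
        (hN m n m≥ n≥)
      where
      rearrange : ∀ a b → ℚ.- (a ℚ.- b) ≡ ℚ.- a ℚ.- ℚ.- b
      rearrange = solve 2 (λ a b → :- (a :- b) := :- a :- :- b) refl

  eventually-bounded : ∀ {x} → IsCauchy x →
    Σ[ B ∈ ℚ ] 0ℚ ℚ.< B × ∃[ N ] (∀ n → N ℕ.≤ n → ℚ.∣ x n ∣ ℚ.≤ B)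
  eventually-bounded {x} cx with cx 1ℚ 0<1
  ... | N , hN = ℚ.∣ x N ∣ ℚ.+ 1ℚ , +-pos (ℚ.0≤∣p∣ (x N)) 0<1 , N , λ n n≥ →
    subst (ℚ._≤ _) (cong ℚ.∣_∣ (rearrange (x N) (x n)))
      (ℚ.≤-trans (ℚ.∣p+q∣≤∣p∣+∣q∣ (x N) (x n ℚ.- x N))
        (ℚ.+-monoʳ-≤ ℚ.∣ x N ∣ (ℚ.<⇒≤ (hN n N n≥ ℕ.≤-refl))))
    where
    rearrange : ∀ a b → a ℚ.+ (b ℚ.- a) ≡ b
    rearrange = solve 2 (λ a b → a :+ (b :- a) := b) refl

  tolerance : ℚ → ℚ → ℚ → ℚ
  tolerance A B ε = inv (A ℚ.+ B) ℚ.* ε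

  tolerance-pos : ∀ {A B ε} → 0ℚ ℚ.< A → 0ℚ ℚ.< B → 0ℚ ℚ.< ε → 0ℚ ℚ.< tolerance A B ε
  tolerance-pos 0<A 0<B 0<ε = *-pos (inv-pos (+-pos (ℚ.<⇒≤ 0<A) 0<B)) 0<ε

  *-close : ∀ {A B ε} a b c d → 0ℚ ℚ.< A → 0ℚ ℚ.< B →
    ℚ.∣ a ∣ ℚ.≤ A → ℚ.∣ d ∣ ℚ.≤ B →
    ℚ.∣ a ℚ.- b ∣ ℚ.< tolerance A B ε → ℚ.∣ c ℚ.- d ∣ ℚ.< tolerance A B ε →
    ℚ.∣ a ℚ.* c ℚ.- b ℚ.* d ∣ ℚ.< ε
  *-close {A} {B} {ε} a b c d 0<A 0<B a≤A d≤B a~b c~d =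
    subst (ℚ._< ε) (cong ℚ.∣_∣ (rearrange a b c d))
      (ℚ.≤-<-trans (ℚ.∣p+q∣≤∣p∣+∣q∣ (a ℚ.* (c ℚ.- d)) (d ℚ.* (a ℚ.- b)))
        (subst (ℚ.∣ a ℚ.* (c ℚ.- d) ∣ ℚ.+ ℚ.∣ d ℚ.* (a ℚ.- b) ∣ ℚ.<_) total
          (ℚ.+-mono-< (bound a (c ℚ.- d) 0<A a≤A c~d)
                      (bound d (a ℚ.- b) 0<B d≤B a~b))))
    where
    δ = tolerance A B ε

    rearrange : ∀ a b c d →
      a ℚ.* (c ℚ.- d) ℚ.+ d ℚ.* (a ℚ.- b) ≡ a ℚ.* c ℚ.- b ℚ.* d
    rearrange = solve 4 (λ a b c d →
      a :* (c :- d) :+ d :* (a :- b) := a :* c :- b :* d) refl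

    bound : ∀ u v {C} → 0ℚ ℚ.< C → ℚ.∣ u ∣ ℚ.≤ C → ℚ.∣ v ∣ ℚ.< δ →
            ℚ.∣ u ℚ.* v ∣ ℚ.< C ℚ.* δ
    bound u v {C} 0<C u≤C v<δ =
      subst (ℚ._< C ℚ.* δ) (sym (ℚ.∣p*q∣≡∣p∣*∣q∣ u v))
        (ℚ.≤-<-trans (*-monoʳ (ℚ.0≤∣p∣ v) u≤C)
          (ℚ.*-monoʳ-<-pos C {{ℚ.positive 0<C}} v<δ))

    total : A ℚ.* δ ℚ.+ B ℚ.* δ ≡ ε
    total = trans
      (solve 4 (λ a b i e → a :* (i :* e) :+ b :* (i :* e) := ((a :+ b) :* i) :* e)
        refl A B (inv (A ℚ.+ B)) ε)
      (trans (cong (ℚ._* ε) (*-inv (+-pos (ℚ.<⇒≤ 0<A) 0<B))) (ℚ.*-identityˡ ε))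

  abstract
    *-cauchy : ∀ {x y} → IsCauchy x → IsCauchy y → IsCauchy (λ n → x n ℚ.* y n)
    *-cauchy {x} {y} cx cy ε 0<ε =
      let A , 0<A , K , hK = eventually-bounded cx
          B , 0<B , L , hL = eventually-bounded cy
          0<δ = tolerance-pos 0<A 0<B 0<ε
          M , hM = cx (tolerance A B ε) 0<δ
          N , hN = cy (tolerance A B ε) 0<δ
      in (K ℕ.⊔ L) ℕ.⊔ (M ℕ.⊔ N) , λ m n m≥ n≥ →
        let m≥KL = ℕ.m⊔n≤o⇒m≤o (K ℕ.⊔ L) (M ℕ.⊔ N) m≥
            n≥KL = ℕ.m⊔n≤o⇒m≤o (K ℕ.⊔ L) (M ℕ.⊔ N) n≥
            m≥MN = ℕ.m⊔n≤o⇒n≤o (K ℕ.⊔ L) (M ℕ.⊔ N) m≥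
            n≥MN = ℕ.m⊔n≤o⇒n≤o (K ℕ.⊔ L) (M ℕ.⊔ N) n≥
        in *-close (x m) (x n) (y m) (y n) 0<A 0<B
             (hK m (ℕ.m⊔n≤o⇒m≤o K L m≥KL)) (hL n (ℕ.m⊔n≤o⇒n≤o K L n≥KL))
             (hM m n (ℕ.m⊔n≤o⇒m≤o M N m≥MN) (ℕ.m⊔n≤o⇒m≤o M N n≥MN))
             (hN m n (ℕ.m⊔n≤o⇒n≤o M N m≥MN) (ℕ.m⊔n≤o⇒n≤o M N n≥MN))

  inv-close : ∀ {δ ε a b} → 0ℚ ℚ.< δ → 0ℚ ℚ.< ε → δ ℚ.≤ a → δ ℚ.≤ b →
    ℚ.∣ b ℚ.- a ∣ ℚ.< ε ℚ.* (δ ℚ.* δ) → ℚ.∣ inv a ℚ.- inv b ∣ ℚ.< ε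
  inv-close {δ} {ε} {a} {b} 0<δ 0<ε δ≤a δ≤b b~a =
    ℚ.*-cancelʳ-<-nonNeg (a ℚ.* b) {{ℚ.nonNegative (ℚ.<⇒≤ 0<ab)}}
      (subst (ℚ._< ε ℚ.* (a ℚ.* b)) (sym eq)
        (ℚ.<-≤-trans b~a (*-monoˡ (ℚ.<⇒≤ 0<ε)
          (*-mono (ℚ.<⇒≤ 0<δ) (ℚ.<⇒≤ 0<a) δ≤a δ≤b))))
    where
    0<a : 0ℚ ℚ.< a
    0<a = ℚ.<-≤-trans 0<δ δ≤a

    0<b : 0ℚ ℚ.< b
    0<b = ℚ.<-≤-trans 0<δ δ≤b

    0<ab : 0ℚ ℚ.< a ℚ.* b
    0<ab = *-pos 0<a 0<b

    expand : (inv a ℚ.- inv b) ℚ.* (a ℚ.* b) ≡ b ℚ.- a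
    expand = trans
      (solve 4 (λ a b i j → (i :- j) :* (a :* b) := b :* (a :* i) :- a :* (b :* j))
        refl a b (inv a) (inv b))
      (cong₂ ℚ._-_
        (trans (cong (b ℚ.*_) (*-inv 0<a)) (ℚ.*-identityʳ b))
        (trans (cong (a ℚ.*_) (*-inv 0<b)) (ℚ.*-identityʳ a)))

    eq : ℚ.∣ inv a ℚ.- inv b ∣ ℚ.* (a ℚ.* b) ≡ ℚ.∣ b ℚ.- a ∣
    eq = trans (cong (ℚ.∣ inv a ℚ.- inv b ∣ ℚ.*_)
                 (sym (ℚ.0≤p⇒∣p∣≡p (ℚ.<⇒≤ 0<ab))))
           (trans (sym (ℚ.∣p*q∣≡∣p∣*∣q∣ (inv a ℚ.- inv b) (a ℚ.* b)))
             (cong ℚ.∣_∣ expand))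

  abstract
    inv-cauchy : ∀ {x δ N} → 0ℚ ℚ.< δ → (∀ n → N ℕ.≤ n → δ ℚ.≤ x n) →
                 IsCauchy x → IsCauchy (λ n → inv (x n))
    inv-cauchy {x} {δ} {N} 0<δ δ≤x cx ε 0<ε =
      let M , hM = cx (ε ℚ.* (δ ℚ.* δ)) (*-pos 0<ε (*-pos 0<δ 0<δ))
      in N ℕ.⊔ M , λ m n m≥ n≥ →
        inv-close 0<δ 0<ε (δ≤x m (ℕ.m⊔n≤o⇒m≤o N M m≥)) (δ≤x n (ℕ.m⊔n≤o⇒m≤o N M n≥))
          (hM n m (ℕ.m⊔n≤o⇒n≤o N M n≥) (ℕ.m⊔n≤o⇒n≤o N M m≥))

infixl 6 _+ᴿ_ _-ᴿ_
infixl 7 _*ᴿ_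
infix  8 -ᴿ_

-ᴿ_ : ℝ → ℝ
-ᴿ x = mkℝ (λ n → ℚ.- seq x n) (neg-cauchy {seq x} (cauchy x))

_+ᴿ_ _*ᴿ_ _-ᴿ_ : ℝ → ℝ → ℝ
x +ᴿ y = mkℝ (λ n → seq x n ℚ.+ seq y n) (+-cauchy {seq x} {seq y} (cauchy x) (cauchy y))
x *ᴿ y = mkℝ (λ n → seq x n ℚ.* seq y n) (*-cauchy {seq x} {seq y} (cauchy x) (cauchy y))
x -ᴿ y = x +ᴿ (-ᴿ y)

-- Finitely many initial terms may be zero, where `inv` returns the junk
-- value 0; they do not affect the real number represented.
inverse⁺ : (x : ℝ) → 0ℝ <ᴿ x → ℝ
inverse⁺ x (δ , 0<δ , N , 0+δ≤x) = mkℝ (λ n → inv (seq x n))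
  (inv-cauchy {seq x} 0<δ
    (λ n n≥ → subst (ℚ._≤ seq x n) (ℚ.+-identityˡ δ) (0+δ≤x n n≥))
    (cauchy x))

------------------------------------------------------------------------
-- Complex numbers

record ℂ : Set where
  constructor _+i_
  field
    re im : ℝ

open ℂ public

infix  4 _≃_ ∣_∣<_
infixl 6 _+_ _-_
infixl 7 _*_
infix  8 -_

_≃_ : ℂ → ℂ → Set
z ≃ w = re z ≃ᴿ re w × im z ≃ᴿ im w

0ℂ 1ℂ : ℂ
0ℂ = 0ℝ +i 0ℝ
1ℂ = 1ℝ +i 0ℝ

-_ : ℂ → ℂ
- z = (-ᴿ re z) +i (-ᴿ im z)

_+_ _-_ _*_ : ℂ → ℂ → ℂ
z + w = (re z +ᴿ re w) +i (im z +ᴿ im w)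
z * w = (re z *ᴿ re w -ᴿ im z *ᴿ im w) +i (re z *ᴿ im w +ᴿ im z *ᴿ re w)
z - w = z + (- w)

normSq : ℂ → ℝ
normSq z = re z *ᴿ re z +ᴿ im z *ᴿ im z

-- |z| < r, where |z| = √(re² + im²), written without the square root.
∣_∣<_ : ℂ → ℝ → Set
∣ z ∣< r = 0ℝ <ᴿ r × normSq z <ᴿ r *ᴿ r

-- Being nonzero in the sense of apartness from 0; classically this is
-- the same as z ≄ 0ℂ, but only the apartness allows one to divide by z.
infix 4 _#0
_#0 : ℂ → Set
z #0 = 0ℝ <ᴿ normSq z

inverse : (z : ℂ) → z #0 → ℂ
inverse z z#0 = (re z *ᴿ r) +i ((-ᴿ im z) *ᴿ r)
  where r = inverse⁺ (normSq z) z#0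

infixl 7 _/_∵_
_/_∵_ : ℂ → (z : ℂ) → z #0 → ℂ
w / z ∵ z#0 = w * inverse z z#0

ℂ-rawSemiring : RawSemiring 0ℓ 0ℓ
ℂ-rawSemiring = record
  { Carrier = ℂ
  ; _≈_     = _≃_
  ; _+_     = _+_
  ; _*_     = _*_
  ; 0#      = 0ℂ
  ; 1#      = 1ℂ
  }

open RawSemiringDefs ℂ-rawSemiring public using (_^_; product)

------------------------------------------------------------------------
-- Unordered infinite sums: the finite partial sums converge to S along
-- the finite subsets of I directed by inclusion.

sumOver : {I : Set} → (I → ℂ) → List I → ℂ
sumOver f F = List.foldr _+_ 0ℂ (List.map f F)

HasSum : {I : Set} → (I → ℂ) → ℂ → Set
HasSum {I} f S = ∀ (ε : ℝ) → 0ℝ <ᴿ ε →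
  Σ[ F₀ ∈ List I ] (∀ (F : List I) → Unique F → F₀ ⊆ F →
    ∣ sumOver f F - S ∣< ε)

------------------------------------------------------------------------
-- The objects in the identity

WeaklyIncreasing : ℕ → Set
WeaklyIncreasing n = Σ[ a ∈ Vec ℕ n ] Linked ℕ._≤_ a

qPochhammer : ℂ → ℂ → ℕ → ℂ
qPochhammer x q n = product {n} (λ j → 1ℂ - x * q ^ toℕ j)

-- With 0-based j and k, the entry a_{j+1} is `Vec.lookup a j`, and
-- k ∈ {1, …, m+1} becomes suc (toℕ k).
denominator : ℂ → ℂ → (m : ℕ) → ∀ {n} → Vec ℕ n → ℂ
denominator q b m {n} a =
  product {n} λ j → product {suc m} λ k →
    1ℂ + b * q ^ (toℕ j ℕ.* suc m ℕ.+ suc (toℕ k) ℕ.+ Vec.lookup a j)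

------------------------------------------------------------------------
-- The denominators are nonzero

NoPole : ℂ → ℂ → Set
NoPole q b = ∀ N → 1 ℕ.≤ N → 1ℂ + b * q ^ N #0

private
  #0-cong : ∀ z w → (∀ n → seq (normSq z) n ≡ seq (normSq w) n) → z #0 → w #0
  #0-cong z w eq (δ , 0<δ , N , h) =
    δ , 0<δ , N , λ n n≥ → subst (_ ℚ.≤_) (eq n) (h n n≥)

  normℚ : ℚ → ℚ → ℚ
  normℚ x y = x ℚ.* x ℚ.+ y ℚ.* y

  normℚ-* : ∀ x y u v →
    normℚ (x ℚ.* u ℚ.+ ℚ.- (y ℚ.* v)) (x ℚ.* v ℚ.+ y ℚ.* u) ≡
    normℚ x y ℚ.* normℚ u v
  normℚ-* = solve 4 (λ x y u v →
    (x :* u :+ :- (y :* v)) :* (x :* u :+ :- (y :* v)) :+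
    (x :* v :+ y :* u) :* (x :* v :+ y :* u) :=
    (x :* x :+ y :* y) :* (u :* u :+ v :* v)) refl

  normSq-* : ∀ z w n →
    seq (normSq (z * w)) n ≡ seq (normSq z) n ℚ.* seq (normSq w) n
  normSq-* z w n = normℚ-* (seq (re z) n) (seq (im z) n) (seq (re w) n) (seq (im w) n)

  normSq-nonNeg : ∀ z n → 0ℚ ℚ.≤ seq (normSq z) n
  normSq-nonNeg z n =
    ℚ.+-mono-≤ (square-nonNeg (seq (re z) n)) (square-nonNeg (seq (im z) n))

1#0 : 1ℂ #0
1#0 = 1ℚ , 0<1 , 0 , λ _ _ → ℚ.≤-refl

*-#0 : ∀ z w → z #0 → w #0 → z * w #0
*-#0 z w (δ , 0<δ , M , hM) (ε , 0<ε , N , hN) =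
  δ ℚ.* ε , *-pos 0<δ 0<ε , M ℕ.⊔ N , λ n n≥ →
    ℚ.≤-trans (ℚ.≤-reflexive (ℚ.+-identityˡ (δ ℚ.* ε)))
      (ℚ.≤-trans
        (*-mono (ℚ.<⇒≤ 0<ε) (normSq-nonNeg z n)
          (subst (ℚ._≤ _) (ℚ.+-identityˡ δ) (hM n (ℕ.m⊔n≤o⇒m≤o M N n≥)))
          (subst (ℚ._≤ _) (ℚ.+-identityˡ ε) (hN n (ℕ.m⊔n≤o⇒n≤o M N n≥))))
        (ℚ.≤-reflexive (sym (normSq-* z w n))))

product-#0 : ∀ n (f : Fin n → ℂ) → (∀ i → f i #0) → product f #0
product-#0 zero    f f#0 = 1#0
product-#0 (suc n) f f#0 =
  *-#0 (f Fin.zero) (product (λ i → f (Fin.suc i)))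
    (f#0 Fin.zero) (product-#0 n (λ i → f (Fin.suc i)) (λ i → f#0 (Fin.suc i)))

disc-* : ∀ z w → ∣ z ∣< 1ℝ → ∣ w ∣< 1ℝ → ∣ z * w ∣< 1ℝ
disc-* z w (0<1ᴿ , δ , 0<δ , M , hM) (_ , ε , 0<ε , N , hN) =
  0<1ᴿ , ε , 0<ε , M ℕ.⊔ N , λ n n≥ →
    ℚ.≤-trans
      (ℚ.+-monoˡ-≤ ε
        (subst (ℚ._≤ seq (normSq w) n) (sym (normSq-* z w n))
          (subst (seq (normSq z) n ℚ.* seq (normSq w) n ℚ.≤_)
            (ℚ.*-identityˡ (seq (normSq w) n))
            (*-monoʳ (normSq-nonNeg w n)
              (ℚ.≤-trans (p≤p+δ (seq (normSq z) n)) (hM n (ℕ.m⊔n≤o⇒m≤o M N n≥)))))))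
      (hN n (ℕ.m⊔n≤o⇒n≤o M N n≥))
  where
  p≤p+δ : ∀ p → p ℚ.≤ p ℚ.+ δ
  p≤p+δ p = subst (ℚ._≤ p ℚ.+ δ) (ℚ.+-identityʳ p) (ℚ.+-monoʳ-≤ p (ℚ.<⇒≤ 0<δ))

disc-^ : ∀ z k → ∣ z ∣< 1ℝ → ∣ z ^ suc k ∣< 1ℝ
disc-^ z zero (0<1ᴿ , δ , 0<δ , N , hN) =
  0<1ᴿ , δ , 0<δ , N , λ n n≥ →
    subst (λ p → p ℚ.+ δ ℚ.≤ 1ℚ)
      (trans (sym (ℚ.*-identityʳ (seq (normSq z) n))) (sym (normSq-* z 1ℂ n))) (hN n n≥)
disc-^ z (suc k) ∣z∣<1 = disc-* z (z ^ suc k) ∣z∣<1 (disc-^ z k ∣z∣<1)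

-- With w = x + iy and |w|² + δ ≤ 1, one has Re (1 - w) ≥ δ/2 because
-- (1 - x) - δ/2 = ((1 - x)² + y² + (1 - x² - y² - δ)) / 2.
1-disc-#0 : ∀ w → ∣ w ∣< 1ℝ → 1ℂ - w #0
1-disc-#0 w (_ , δ , 0<δ , N , hN) =
  h ℚ.* h , *-pos 0<h 0<h , N , λ n n≥ →
    bound (seq (re w) n) (seq (im w) n) (hN n n≥)
  where
  h = ½ ℚ.* δ
  0<h = half-pos 0<δ

  split : ∀ x y δ → 1ℚ ℚ.- x ≡
    ½ ℚ.* δ ℚ.+ ½ ℚ.* (normℚ (1ℚ ℚ.- x) y ℚ.+ (1ℚ ℚ.- (normℚ x y ℚ.+ δ)))
  split = solve 3 (λ x y δ → con 1ℚ :- x :=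
    con ½ :* δ :+ con ½ :*
      (((con 1ℚ :- x) :* (con 1ℚ :- x) :+ y :* y) :+
       (con 1ℚ :- ((x :* x :+ y :* y) :+ δ)))) refl

  0≤norm : ∀ x y → 0ℚ ℚ.≤ normℚ x y
  0≤norm x y = ℚ.+-mono-≤ (square-nonNeg x) (square-nonNeg y)

  h≤1-x : ∀ x y → normℚ x y ℚ.+ δ ℚ.≤ 1ℚ → h ℚ.≤ 1ℚ ℚ.- x
  h≤1-x x y s≤1 = subst (h ℚ.≤_) (sym (split x y δ))
    (subst (ℚ._≤ h ℚ.+ ½ ℚ.* rest) (ℚ.+-identityʳ h) (ℚ.+-monoʳ-≤ h
      (*-monoˡ {½} {0ℚ} {rest} (ℚ.<⇒≤ 0<½)
        (ℚ.+-mono-≤ (0≤norm (1ℚ ℚ.- x) y)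
          (subst (ℚ._≤ 1ℚ ℚ.- s) (ℚ.+-inverseʳ s) (ℚ.+-monoˡ-≤ (ℚ.- s) s≤1))))))
    where
    s = normℚ x y ℚ.+ δ
    rest = normℚ (1ℚ ℚ.- x) y ℚ.+ (1ℚ ℚ.- s)

  bound : ∀ x y → normℚ x y ℚ.+ δ ℚ.≤ 1ℚ →
    0ℚ ℚ.+ h ℚ.* h ℚ.≤ normℚ (1ℚ ℚ.+ ℚ.- x) (0ℚ ℚ.+ ℚ.- y)
  bound x y s≤1 =
    subst (ℚ._≤ normℚ (1ℚ ℚ.+ ℚ.- x) (0ℚ ℚ.+ ℚ.- y)) (ℚ.+-comm (h ℚ.* h) 0ℚ)
      (ℚ.+-mono-≤
        (*-mono (ℚ.<⇒≤ 0<h) (ℚ.≤-trans (ℚ.<⇒≤ 0<h) h≤) h≤ h≤)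
        (square-nonNeg (0ℚ ℚ.+ ℚ.- y)))
    where h≤ = h≤1-x x y s≤1

denominator-#0 : ∀ q b → NoPole q b → ∀ m {n} (a : Vec ℕ n) →
                 denominator q b m a #0
denominator-#0 q b hb m {n} a =
  product-#0 n (λ j → product (factor j)) λ j → product-#0 (suc m) (factor j) λ k →
    hb (toℕ j ℕ.* suc m ℕ.+ suc (toℕ k) ℕ.+ Vec.lookup a j)
      (ℕ.≤-trans (ℕ.≤-trans (ℕ.s≤s ℕ.z≤n) (ℕ.m≤n+m (suc (toℕ k)) (toℕ j ℕ.* suc m)))
        (ℕ.m≤m+n _ (Vec.lookup a j)))
  where
  factor : Fin n → Fin (suc m) → ℂ
  factor j k = 1ℂ + b * q ^ (toℕ j ℕ.* suc m ℕ.+ suc (toℕ k) ℕ.+ Vec.lookup a j)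

qPochhammer-q^m-#0 : ∀ q → ∣ q ∣< 1ℝ → ∀ m .{{_ : ℕ.NonZero m}} n →
                     qPochhammer (q ^ m) (q ^ m) n #0
qPochhammer-q^m-#0 q ∣q∣<1 (suc m) n = product-#0 n (λ j → 1ℂ - p * p ^ toℕ j) λ j →
  1-disc-#0 (p ^ suc (toℕ j)) (disc-^ p (toℕ j) (disc-^ q m ∣q∣<1))
  where p = q ^ suc m

qPochhammer-bq-#0 : ∀ q b → NoPole q b → ∀ n → qPochhammer (- (b * q)) q n #0
qPochhammer-bq-#0 q b hb n = product-#0 n (λ j → 1ℂ - (- (b * q)) * q ^ toℕ j) λ j →
  #0-cong (1ℂ + b * q ^ suc (toℕ j)) (1ℂ - (- (b * q)) * q ^ toℕ j)
    (λ i → cong₂ normℚ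
      (eq-re (seq (re b) i) (seq (im b) i) (seq (re q) i) (seq (im q) i)
             (seq (re (q ^ toℕ j)) i) (seq (im (q ^ toℕ j)) i))
      (eq-im (seq (re b) i) (seq (im b) i) (seq (re q) i) (seq (im q) i)
             (seq (re (q ^ toℕ j)) i) (seq (im (q ^ toℕ j)) i)))
    (hb (suc (toℕ j)) (ℕ.s≤s ℕ.z≤n))
  where
  eq-re : ∀ b b′ q q′ p p′ →
    1ℚ ℚ.+ (b ℚ.* (q ℚ.* p ℚ.+ ℚ.- (q′ ℚ.* p′)) ℚ.+
            ℚ.- (b′ ℚ.* (q ℚ.* p′ ℚ.+ q′ ℚ.* p))) ≡
    1ℚ ℚ.+ ℚ.- ((ℚ.- (b ℚ.* q ℚ.+ ℚ.- (b′ ℚ.* q′))) ℚ.* p ℚ.+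
            ℚ.- ((ℚ.- (b ℚ.* q′ ℚ.+ b′ ℚ.* q)) ℚ.* p′))
  eq-re = solve 6 (λ b b′ q q′ p p′ →
    con 1ℚ :+ (b :* (q :* p :+ :- (q′ :* p′)) :+
            :- (b′ :* (q :* p′ :+ q′ :* p))) :=
    con 1ℚ :+ :- ((:- (b :* q :+ :- (b′ :* q′))) :* p :+
            :- ((:- (b :* q′ :+ b′ :* q)) :* p′))) refl

  eq-im : ∀ b b′ q q′ p p′ →
    0ℚ ℚ.+ (b ℚ.* (q ℚ.* p′ ℚ.+ q′ ℚ.* p) ℚ.+
            b′ ℚ.* (q ℚ.* p ℚ.+ ℚ.- (q′ ℚ.* p′))) ≡
    0ℚ ℚ.+ ℚ.- ((ℚ.- (b ℚ.* q ℚ.+ ℚ.- (b′ ℚ.* q′))) ℚ.* p′ ℚ.+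
            (ℚ.- (b ℚ.* q′ ℚ.+ b′ ℚ.* q)) ℚ.* p)
  eq-im = solve 6 (λ b b′ q q′ p p′ →
    con 0ℚ :+ (b :* (q :* p′ :+ q′ :* p) :+
            b′ :* (q :* p :+ :- (q′ :* p′))) :=
    con 0ℚ :+ :- ((:- (b :* q :+ :- (b′ :* q′))) :* p′ :+
            (:- (b :* q′ :+ b′ :* q)) :* p)) refl

{-# OPTIONS --safe #-}
module Submission where

-- Write S(s, n, A) for the sum over A ≤ a₁ ≤ … ≤ aₙ with b replaced by b q^s.
-- Its closed form is q^(mnA) / ((q^m; q^m)ₙ ∏_{k=1}^{mn} (1 + b q^(s+A+k))), and
-- splitting off the first entry gives the telescoping identity
--   S(s, n+1, A) = u(A) S(s+m+1, n, A) + S(s, n+1, A+1),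
-- where u(A) is the factor contributed by a₁ = A.  Induction along this recursion
-- bounds by O(t^k) the error of the partial sum over tuples with entries < k, for
-- some t < 1 with |q| ≤ t².  A tuple left out of it has sum of entries at least k,
-- so its term is O(t^k · t^(a₁+…+aₙ)), and the t^(a₁+…+aₙ) are summable.
-- All operations on ℂ act termwise on Cauchy sequences, so this is carried out for
-- Gaussian rationals, with constants valid for all sufficiently large indices.

open import Defs
open import Algebra.Bundles using (CommutativeRing)
open import Algebra.Core using (Op₂)
open import Algebra.Structures using (IsCommutativeSemiring)
import Algebra.Properties.CommutativeMonoid.Sum as CommutativeMonoidSum
import Algebra.Properties.CommutativeSemigroup as CommutativeSemigroupProperties
import Algebra.Properties.CommutativeSemiring.Exp as Exp
import Algebra.Solver.Ring.AlmostCommutativeRing as ACR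
import Algebra.Solver.Ring.Simple as RingSolver
open import Data.Fin.Base as Fin using (Fin; toℕ)
import Data.Fin.Properties as Fin
open import Data.Integer.Base as ℤ using (+_)
import Data.Integer.Properties as ℤ
open import Data.List.Base as List using (List; []; _∷_; _++_)
import Data.List.Extrema.Nat as Extrema
open import Data.List.Membership.Propositional using (_∈_)
open import Data.List.Membership.Propositional.Properties
  using (∈-++⁺ˡ; ∈-++⁺ʳ; ∈-map⁺; ∈-map⁻; ∈-∃++)
import Data.List.Properties as List
open import Data.List.Relation.Binary.Disjoint.Propositional using (Disjoint)
open import Data.List.Relation.Binary.Permutation.Propositional
  using (_↭_; ↭-refl; ↭-sym; ↭-trans; prep; ↭⇒↭ₛ)
open import Data.List.Relation.Binary.Permutation.Propositional.Properties
  using (shift; ∈-resp-↭; All-resp-↭) renaming (map⁺ to ↭-map⁺)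
import Data.List.Relation.Binary.Permutation.Setoid.Properties as ↭ₛ
open import Data.List.Relation.Binary.Subset.Propositional using (_⊆_)
import Data.List.Relation.Binary.Subset.Propositional.Properties as ⊆
open import Data.List.Relation.Unary.All as All using (All; []; _∷_)
import Data.List.Relation.Unary.All.Properties as All
open import Data.List.Relation.Unary.AllPairs using ([]; _∷_)
open import Data.List.Relation.Unary.Any using (here; there)
open import Data.List.Relation.Unary.Unique.Propositional using (Unique)
import Data.List.Relation.Unary.Unique.Propositional.Properties as Unique
open import Data.Nat.Base as ℕ using (ℕ; zero; suc; NonZero; _≤_)
import Data.Nat.Properties as ℕ
open import Data.Product.Base using (Σ; Σ-syntax; ∃-syntax; _×_; _,_; proj₁; proj₂)
open import Data.Product.Properties using (≡-dec)
open import Data.Rational.Base as ℚ using (ℚ; 0ℚ; 1ℚ; ½; mkℚ)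
open import Data.Rational.Literals using (fromℤ)
import Data.Rational.Properties as ℚ
open import Data.Rational.Solver using (module +-*-Solver)
import Data.Rational.Unnormalised.Base as ℚᵘ
import Data.Rational.Unnormalised.Properties as ℚᵘ
open import Data.Sum.Base as Sum using (_⊎_; inj₁; inj₂)
open import Data.Vec.Base as Vec using (Vec; []; _∷_)
import Data.Vec.Properties as Vec
open import Data.Vec.Relation.Unary.Linked as Linked using (Linked; [-]; _∷_)
open import Level using (0ℓ)
open import Relation.Binary.Definitions using (DecidableEquality)
open import Relation.Binary.PropositionalEquality
  using (_≡_; _≢_; refl; sym; trans; cong; cong₂; subst; subst₂; setoid; isEquivalence; module ≡-Reasoning)
open import Relation.Nullary using (yes; no; contradiction)

open +-*-Solver using (solve; _:=_; _:+_; _:*_; _:-_; :-_; con)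
open Exp (CommutativeRing.commutativeSemiring ℚ.+-*-commutativeRing) using () renaming
  (_^_ to _^ℚ_; ^-homo-* to ^ℚ-homo-*; ^-distrib-* to ^ℚ-distrib-*)

-- Ordered-field facts about ℚ

0≤1 : 0ℚ ℚ.≤ 1ℚ
0≤1 = ℚ.<⇒≤ (ℚ.positive⁻¹ 1ℚ)

0<½ : 0ℚ ℚ.< ½
0<½ = ℚ.positive⁻¹ ½

½≤1 : ½ ℚ.≤ 1ℚ
½≤1 = ℚ.*≤* (ℤ.+≤+ (ℕ.s≤s ℕ.z≤n))

*-monoˡ-≤ : ∀ {p q r} → 0ℚ ℚ.≤ p → q ℚ.≤ r → p ℚ.* q ℚ.≤ p ℚ.* r
*-monoˡ-≤ {p} 0≤p = ℚ.*-monoˡ-≤-nonNeg p {{ℚ.nonNegative 0≤p}}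

*-monoʳ-≤ : ∀ {p q r} → 0ℚ ℚ.≤ p → q ℚ.≤ r → q ℚ.* p ℚ.≤ r ℚ.* p
*-monoʳ-≤ {p} 0≤p = ℚ.*-monoʳ-≤-nonNeg p {{ℚ.nonNegative 0≤p}}

*-mono-≤ : ∀ {p q r s} → 0ℚ ℚ.≤ q → 0ℚ ℚ.≤ r → p ℚ.≤ r → q ℚ.≤ s → p ℚ.* q ℚ.≤ r ℚ.* s
*-mono-≤ 0≤q 0≤r p≤r q≤s = ℚ.≤-trans (*-monoʳ-≤ 0≤q p≤r) (*-monoˡ-≤ 0≤r q≤s)

*-nonNeg : ∀ {p q} → 0ℚ ℚ.≤ p → 0ℚ ℚ.≤ q → 0ℚ ℚ.≤ p ℚ.* q
*-nonNeg {p} {q} 0≤p 0≤q = subst (ℚ._≤ p ℚ.* q) (ℚ.*-zeroʳ p) (*-monoˡ-≤ 0≤p 0≤q)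

*-pos : ∀ {p q} → 0ℚ ℚ.< p → 0ℚ ℚ.< q → 0ℚ ℚ.< p ℚ.* q
*-pos {p} {q} 0<p 0<q = ℚ.positive⁻¹ (p ℚ.* q)
  {{ℚ.pos*pos⇒pos p {{ℚ.positive 0<p}} q {{ℚ.positive 0<q}}}}

+-nonNeg : ∀ {p q} → 0ℚ ℚ.≤ p → 0ℚ ℚ.≤ q → 0ℚ ℚ.≤ p ℚ.+ q
+-nonNeg = ℚ.+-mono-≤

p≤p+q : ∀ {p q} → 0ℚ ℚ.≤ q → p ℚ.≤ p ℚ.+ q
p≤p+q {p} {q} 0≤q = subst (ℚ._≤ p ℚ.+ q) (ℚ.+-identityʳ p) (ℚ.+-monoʳ-≤ p 0≤q)

p≤q+p : ∀ {p q} → 0ℚ ℚ.≤ q → p ℚ.≤ q ℚ.+ p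
p≤q+p {p} {q} 0≤q = subst (p ℚ.≤_) (ℚ.+-comm p q) (p≤p+q 0≤q)

p≤q⇒0≤q-p : ∀ {p q} → p ℚ.≤ q → 0ℚ ℚ.≤ q ℚ.- p
p≤q⇒0≤q-p {p} {q} p≤q = subst (ℚ._≤ q ℚ.- p) (ℚ.+-inverseʳ p) (ℚ.+-monoˡ-≤ (ℚ.- p) p≤q)

p<q⇒0<q-p : ∀ {p q} → p ℚ.< q → 0ℚ ℚ.< q ℚ.- p
p<q⇒0<q-p {p} {q} p<q = subst (ℚ._< q ℚ.- p) (ℚ.+-inverseʳ p) (ℚ.+-monoˡ-< (ℚ.- p) p<q)

square-nonNeg : ∀ p → 0ℚ ℚ.≤ p ℚ.* p
square-nonNeg p with ℚ.≤-total 0ℚ p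
... | inj₁ 0≤p = *-nonNeg 0≤p 0≤p
... | inj₂ p≤0 = subst (ℚ._≤ p ℚ.* p) (ℚ.*-zeroʳ p)
                   (ℚ.*-monoˡ-≤-nonPos p {{ℚ.nonPositive p≤0}} p≤0)

-- Moduli are available only through their squares, so this takes the place of monotonicity of the
-- square root.
square-cancel-≤ : ∀ {p q} → 0ℚ ℚ.≤ q → p ℚ.* p ℚ.≤ q ℚ.* q → p ℚ.≤ q
square-cancel-≤ {p} {q} 0≤q p²≤q² with p ℚ.≤? q
... | yes p≤q = p≤q
... | no  p≰q = contradiction (ℚ.<-≤-trans q²<p² p²≤q²) (ℚ.<-irrefl refl)
  where
  q<p = ℚ.≰⇒> p≰q
  q²<p² : q ℚ.* q ℚ.< p ℚ.* p
  q²<p² = ℚ.≤-<-trans (*-monoˡ-≤ 0≤q (ℚ.<⇒≤ q<p))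
    (ℚ.*-monoˡ-<-pos p {{ℚ.positive (ℚ.≤-<-trans 0≤q q<p)}} q<p)

*-inv : ∀ {p} → p ≢ 0ℚ → p ℚ.* inv p ≡ 1ℚ
*-inv {p} p≢0 with p ℚ.≟ 0ℚ
... | yes p≡0 = contradiction p≡0 p≢0
... | no  p≢0 = ℚ.*-inverseʳ p {{ℚ.≢-nonZero p≢0}}

pos⇒≢0 : ∀ {p} → 0ℚ ℚ.< p → p ≢ 0ℚ
pos⇒≢0 0<p p≡0 = ℚ.<⇒≢ 0<p (sym p≡0)

inv-pos : ∀ {p} → 0ℚ ℚ.< p → 0ℚ ℚ.< inv p
inv-pos {p} 0<p = ℚ.*-cancelˡ-<-nonNeg p {{ℚ.nonNegative (ℚ.<⇒≤ 0<p)}}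
  (subst₂ ℚ._<_ (sym (ℚ.*-zeroʳ p)) (sym (*-inv (pos⇒≢0 0<p))) (ℚ.positive⁻¹ 1ℚ))

inv-antimono-≤ : ∀ {p q} → 0ℚ ℚ.< p → p ℚ.≤ q → inv q ℚ.≤ inv p
inv-antimono-≤ {p} {q} 0<p p≤q =
  subst₂ ℚ._≤_
    (trans (solve 3 (λ p i j → p :* (i :* j) := p :* i :* j) refl p (inv p) (inv q))
      (trans (cong (ℚ._* inv q) (*-inv (pos⇒≢0 0<p))) (ℚ.*-identityˡ (inv q))))
    (trans (solve 3 (λ q i j → q :* (i :* j) := q :* j :* i) refl q (inv p) (inv q))
      (trans (cong (ℚ._* inv p) (*-inv (pos⇒≢0 0<q))) (ℚ.*-identityˡ (inv p))))
    (*-monoʳ-≤ (*-nonNeg (ℚ.<⇒≤ (inv-pos 0<p)) (ℚ.<⇒≤ (inv-pos 0<q))) p≤q)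
  where 0<q = ℚ.<-≤-trans 0<p p≤q

p≤[1+p]² : ∀ {p} → 0ℚ ℚ.≤ p → p ℚ.≤ (1ℚ ℚ.+ p) ℚ.* (1ℚ ℚ.+ p)
p≤[1+p]² {p} 0≤p = subst (p ℚ.≤_)
  (solve 1 (λ p → p :+ (con 1ℚ :+ p :+ p :* p) := (con 1ℚ :+ p) :* (con 1ℚ :+ p)) refl p)
  (p≤p+q (+-nonNeg (+-nonNeg 0≤1 0≤p) (square-nonNeg p)))

-- A rational stand-in for a square root: the mean of 1 and `p` is at least √p, and it stays below 1
-- when `p` does.
AM-GM : ∀ p → p ℚ.≤ (½ ℚ.* (1ℚ ℚ.+ p)) ℚ.* (½ ℚ.* (1ℚ ℚ.+ p))
AM-GM p = subst (p ℚ.≤_)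
  (solve 1 (λ p → p :+ (con ½ :* (con 1ℚ :- p)) :* (con ½ :* (con 1ℚ :- p)) :=
    (con ½ :* (con 1ℚ :+ p)) :* (con ½ :* (con 1ℚ :+ p))) refl p)
  (p≤p+q (square-nonNeg (½ ℚ.* (1ℚ ℚ.- p))))

^-nonNeg : ∀ {p} → 0ℚ ℚ.≤ p → ∀ n → 0ℚ ℚ.≤ p ^ℚ n
^-nonNeg 0≤p zero    = 0≤1
^-nonNeg 0≤p (suc n) = *-nonNeg 0≤p (^-nonNeg 0≤p n)

^-≤1 : ∀ {p} → 0ℚ ℚ.≤ p → p ℚ.≤ 1ℚ → ∀ n → p ^ℚ n ℚ.≤ 1ℚ
^-≤1 0≤p p≤1 zero    = ℚ.≤-refl
^-≤1 {p} 0≤p p≤1 (suc n) = subst (p ^ℚ suc n ℚ.≤_) (ℚ.*-identityˡ 1ℚ)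
  (*-mono-≤ (^-nonNeg 0≤p n) 0≤1 p≤1 (^-≤1 0≤p p≤1 n))

^-antimono-≤ : ∀ {p} → 0ℚ ℚ.≤ p → p ℚ.≤ 1ℚ → ∀ {m n} → m ℕ.≤ n → p ^ℚ n ℚ.≤ p ^ℚ m
^-antimono-≤ {p} 0≤p p≤1 {m} {n} m≤n = subst₂ ℚ._≤_
  (trans (sym (^ℚ-homo-* p m (n ℕ.∸ m))) (cong (p ^ℚ_) (ℕ.m+[n∸m]≡n m≤n))) (ℚ.*-identityʳ (p ^ℚ m))
  (*-monoˡ-≤ (^-nonNeg 0≤p m) (^-≤1 0≤p p≤1 (n ℕ.∸ m)))

p*p≤p : ∀ {p} → 0ℚ ℚ.≤ p → p ℚ.≤ 1ℚ → p ℚ.* p ℚ.≤ p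
p*p≤p {p} 0≤p p≤1 = subst (p ℚ.* p ℚ.≤_) (ℚ.*-identityʳ p) (*-monoˡ-≤ 0≤p p≤1)

-- The Archimedean property and geometric decay

fromℕ : ℕ → ℚ
fromℕ n = fromℤ (+ n)

fromℕ-suc : ∀ n → fromℕ (suc n) ≡ 1ℚ ℚ.+ fromℕ n
fromℕ-suc n = ℚ.toℚᵘ-injective (ℚᵘ.≃-sym (ℚᵘ.≃-trans (ℚ.toℚᵘ-homo-+ 1ℚ (fromℕ n))
  (ℚᵘ.*≡* (cong (λ k → (+ 1 ℤ.+ k) ℤ.* + 1) (ℤ.*-identityʳ (+ n))))))

-- The witness is the denominator of `p`: multiplying by it leaves the numerator, a positive
-- integer.
archimedean : ∀ p → 0ℚ ℚ.< p → ∃[ n ] 1ℚ ℚ.≤ fromℕ n ℚ.* p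
archimedean p@(mkℚ (+ suc k) d-1 _) 0<p = suc d-1 , ℚ.toℚᵘ-cancel-≤
  (ℚᵘ.≤-respʳ-≃ (ℚᵘ.≃-sym (ℚ.toℚᵘ-homo-* (fromℕ (suc d-1)) p))
    (ℚᵘ.*≤* (subst₂ ℤ._≤_ (sym (ℤ.*-identityˡ (+ 1 ℤ.* + suc d-1))) (sym (ℤ.*-identityʳ (+ suc d-1 ℤ.* + suc k)))
      (subst₂ ℤ._≤_ (sym (ℤ.*-identityˡ (+ suc d-1))) (ℤ.pos-* (suc d-1) (suc k)) (ℤ.+≤+ (ℕ.m≤m*n (suc d-1) (suc k)))))))
archimedean (mkℚ (+ zero) d-1 _) (ℚ.*<* (ℤ.+<+ ()))
archimedean (mkℚ (ℤ.-[1+ k ]) d-1 _) (ℚ.*<* ())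

-- A division-free form of Bernoulli's inequality. Passing from n to n + 1 lowers the left side by
-- tⁿ (n + 1) (1 - t)², which is nonnegative.
bernoulli : ∀ {t} → 0ℚ ℚ.≤ t → ∀ n → t ^ℚ n ℚ.* (1ℚ ℚ.+ fromℕ n ℚ.* (1ℚ ℚ.- t)) ℚ.≤ 1ℚ
bernoulli {t} 0≤t zero = ℚ.≤-reflexive (solve 1 (λ x → con 1ℚ :* (con 1ℚ :+ con 0ℚ :* x) := con 1ℚ) refl (1ℚ ℚ.- t))
bernoulli {t} 0≤t (suc n) = ℚ.≤-trans
  (ℚ.≤-reflexive (cong (λ k → t ^ℚ suc n ℚ.* (1ℚ ℚ.+ k ℚ.* (1ℚ ℚ.- t))) (fromℕ-suc n)))
  (ℚ.≤-trans (subst (t ^ℚ suc n ℚ.* (1ℚ ℚ.+ (1ℚ ℚ.+ fromℕ n) ℚ.* (1ℚ ℚ.- t)) ℚ.≤_)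
    (solve 3 (λ t k u → t :* u :* (con 1ℚ :+ (con 1ℚ :+ k) :* (con 1ℚ :- t)) :+
                        u :* ((con 1ℚ :+ k) :* ((con 1ℚ :- t) :* (con 1ℚ :- t))) :=
                        u :* (con 1ℚ :+ k :* (con 1ℚ :- t))) refl t (fromℕ n) (t ^ℚ n))
    (p≤p+q (*-nonNeg (^-nonNeg 0≤t n) (*-nonNeg (+-nonNeg 0≤1 (0≤fromℕ n)) (square-nonNeg (1ℚ ℚ.- t))))))
    (bernoulli 0≤t n))
  where
  0≤fromℕ : ∀ n → 0ℚ ℚ.≤ fromℕ n
  0≤fromℕ zero    = ℚ.≤-refl
  0≤fromℕ (suc n) = subst (0ℚ ℚ.≤_) (sym (fromℕ-suc n)) (+-nonNeg 0≤1 (0≤fromℕ n))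

^-null : ∀ {t C ε} → 0ℚ ℚ.≤ t → t ℚ.< 1ℚ → 0ℚ ℚ.≤ C → 0ℚ ℚ.< ε → ∃[ n ] C ℚ.* t ^ℚ n ℚ.≤ ε
^-null {t} {C} {ε} 0≤t t<1 0≤C 0<ε =
  let 0<1+C = ℚ.<-≤-trans (ℚ.positive⁻¹ 1ℚ) (p≤p+q 0≤C)
      -- Scaled so that n x ≥ 1 turns the bound tⁿ n (1 - t) ≤ 1 into C tⁿ ≤ ε. The divisor is 1 + C
      -- because C may be zero.
      x   = (1ℚ ℚ.- t) ℚ.* (inv (1ℚ ℚ.+ C) ℚ.* ε)
      n , 1≤nx = archimedean x (*-pos (p<q⇒0<q-p t<1) (*-pos (inv-pos 0<1+C) 0<ε))
      0≤tⁿ = ^-nonNeg 0≤t n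
  in n , (begin
    C ℚ.* t ^ℚ n
      ≤⟨ *-monoʳ-≤ {p = t ^ℚ n} {C} {1ℚ ℚ.+ C} 0≤tⁿ (p≤q+p 0≤1) ⟩
    (1ℚ ℚ.+ C) ℚ.* t ^ℚ n
      ≡⟨ ℚ.*-identityʳ _ ⟨
    (1ℚ ℚ.+ C) ℚ.* t ^ℚ n ℚ.* 1ℚ
      ≤⟨ *-monoˡ-≤ (*-nonNeg (ℚ.<⇒≤ 0<1+C) 0≤tⁿ) 1≤nx ⟩
    (1ℚ ℚ.+ C) ℚ.* t ^ℚ n ℚ.* (fromℕ n ℚ.* x)
      ≡⟨ solve 6 (λ c u n s i e → c :* u :* (n :* (s :* (i :* e))) := (c :* i) :* (u :* (n :* s)) :* e)
           refl (1ℚ ℚ.+ C) (t ^ℚ n) (fromℕ n) (1ℚ ℚ.- t) (inv (1ℚ ℚ.+ C)) ε ⟩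
    ((1ℚ ℚ.+ C) ℚ.* inv (1ℚ ℚ.+ C)) ℚ.* (t ^ℚ n ℚ.* (fromℕ n ℚ.* (1ℚ ℚ.- t))) ℚ.* ε
      ≡⟨ cong (λ z → z ℚ.* (t ^ℚ n ℚ.* (fromℕ n ℚ.* (1ℚ ℚ.- t))) ℚ.* ε) (*-inv (pos⇒≢0 0<1+C)) ⟩
    1ℚ ℚ.* (t ^ℚ n ℚ.* (fromℕ n ℚ.* (1ℚ ℚ.- t))) ℚ.* ε
      ≡⟨ cong (ℚ._* ε) (ℚ.*-identityˡ (t ^ℚ n ℚ.* (fromℕ n ℚ.* (1ℚ ℚ.- t)))) ⟩
    (t ^ℚ n ℚ.* (fromℕ n ℚ.* (1ℚ ℚ.- t))) ℚ.* ε
      ≤⟨ *-monoʳ-≤ (ℚ.<⇒≤ 0<ε) (ℚ.≤-trans (*-monoˡ-≤ 0≤tⁿ (p≤q+p 0≤1)) (bernoulli 0≤t n)) ⟩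
    1ℚ ℚ.* ε
      ≡⟨ ℚ.*-identityˡ ε ⟩
    ε ∎)
  where open ℚ.≤-Reasoning

-- Gaussian rationals

ℚ[i] : Set
ℚ[i] = ℚ × ℚ

infixl 6 _⊕_
infixl 7 _⊗_
infix  8 ⊝_
infix  9 _⁻¹

opaque
  _⊕_ _⊗_ : ℚ[i] → ℚ[i] → ℚ[i]
  (x , y) ⊕ (u , v) = x ℚ.+ u , y ℚ.+ v
  (x , y) ⊗ (u , v) = x ℚ.* u ℚ.+ ℚ.- (y ℚ.* v) , x ℚ.* v ℚ.+ y ℚ.* u

  ⊝_ : ℚ[i] → ℚ[i]
  ⊝ (x , y) = ℚ.- x , ℚ.- y

  𝟎 𝟏 : ℚ[i]
  𝟎 = 0ℚ , 0ℚ
  𝟏 = 1ℚ , 0ℚ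

  norm : ℚ[i] → ℚ
  norm (x , y) = x ℚ.* x ℚ.+ y ℚ.* y

  _⁻¹ : ℚ[i] → ℚ[i]
  z@(x , y) ⁻¹ = x ℚ.* inv (norm z) , (ℚ.- y) ℚ.* inv (norm z)

opaque
  unfolding _⊗_

  ⊕-assoc : ∀ z w v → (z ⊕ w) ⊕ v ≡ z ⊕ (w ⊕ v)
  ⊕-assoc (a , b) (c , d) (e , f) = cong₂ _,_ (ℚ.+-assoc a c e) (ℚ.+-assoc b d f)

  ⊕-comm : ∀ z w → z ⊕ w ≡ w ⊕ z
  ⊕-comm (a , b) (c , d) = cong₂ _,_ (ℚ.+-comm a c) (ℚ.+-comm b d)

  ⊕-identityˡ : ∀ z → 𝟎 ⊕ z ≡ z
  ⊕-identityˡ (a , b) = cong₂ _,_ (ℚ.+-identityˡ a) (ℚ.+-identityˡ b)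

  ⊕-identityʳ : ∀ z → z ⊕ 𝟎 ≡ z
  ⊕-identityʳ (a , b) = cong₂ _,_ (ℚ.+-identityʳ a) (ℚ.+-identityʳ b)

  ⊝-inverseˡ : ∀ z → ⊝ z ⊕ z ≡ 𝟎
  ⊝-inverseˡ (a , b) = cong₂ _,_ (ℚ.+-inverseˡ a) (ℚ.+-inverseˡ b)

  ⊝-inverseʳ : ∀ z → z ⊕ ⊝ z ≡ 𝟎
  ⊝-inverseʳ (a , b) = cong₂ _,_ (ℚ.+-inverseʳ a) (ℚ.+-inverseʳ b)

  ⊗-assoc : ∀ z w v → (z ⊗ w) ⊗ v ≡ z ⊗ (w ⊗ v)
  ⊗-assoc (a , b) (c , d) (e , f) = cong₂ _,_
    (solve 6 (λ a b c d e f → (a :* c :+ :- (b :* d)) :* e :+ :- ((a :* d :+ b :* c) :* f) :=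
      a :* (c :* e :+ :- (d :* f)) :+ :- (b :* (c :* f :+ d :* e))) refl a b c d e f)
    (solve 6 (λ a b c d e f → (a :* c :+ :- (b :* d)) :* f :+ (a :* d :+ b :* c) :* e :=
      a :* (c :* f :+ d :* e) :+ b :* (c :* e :+ :- (d :* f))) refl a b c d e f)

  ⊗-comm : ∀ z w → z ⊗ w ≡ w ⊗ z
  ⊗-comm (a , b) (c , d) = cong₂ _,_
    (solve 4 (λ a b c d → a :* c :+ :- (b :* d) := c :* a :+ :- (d :* b)) refl a b c d)
    (solve 4 (λ a b c d → a :* d :+ b :* c := c :* b :+ d :* a) refl a b c d)

  ⊗-identityˡ : ∀ z → 𝟏 ⊗ z ≡ z
  ⊗-identityˡ (a , b) = cong₂ _,_
    (solve 2 (λ a b → con 1ℚ :* a :+ :- (con 0ℚ :* b) := a) refl a b)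
    (solve 2 (λ a b → con 1ℚ :* b :+ con 0ℚ :* a := b) refl a b)

  ⊗-identityʳ : ∀ z → z ⊗ 𝟏 ≡ z
  ⊗-identityʳ z = trans (⊗-comm z 𝟏) (⊗-identityˡ z)

  ⊗-distribˡ-⊕ : ∀ z w v → z ⊗ (w ⊕ v) ≡ z ⊗ w ⊕ z ⊗ v
  ⊗-distribˡ-⊕ (a , b) (c , d) (e , f) = cong₂ _,_
    (solve 6 (λ a b c d e f → a :* (c :+ e) :+ :- (b :* (d :+ f)) :=
      (a :* c :+ :- (b :* d)) :+ (a :* e :+ :- (b :* f))) refl a b c d e f)
    (solve 6 (λ a b c d e f → a :* (d :+ f) :+ b :* (c :+ e) :=
      (a :* d :+ b :* c) :+ (a :* f :+ b :* e)) refl a b c d e f)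

  ⊗-distribʳ-⊕ : ∀ z w v → (w ⊕ v) ⊗ z ≡ w ⊗ z ⊕ v ⊗ z
  ⊗-distribʳ-⊕ z w v = trans (⊗-comm (w ⊕ v) z)
    (trans (⊗-distribˡ-⊕ z w v) (cong₂ _⊕_ (⊗-comm z w) (⊗-comm z v)))

ℚ[i]-commutativeRing : CommutativeRing 0ℓ 0ℓ
ℚ[i]-commutativeRing = record
  { Carrier = ℚ[i] ; _≈_ = _≡_ ; _+_ = _⊕_ ; _*_ = _⊗_ ; -_ = ⊝_ ; 0# = 𝟎 ; 1# = 𝟏
  ; isCommutativeRing = record
    { isRing = record
      { +-isAbelianGroup = record
        { isGroup = record
          { isMonoid = record
            { isSemigroup = record
              { isMagma = record { isEquivalence = isEquivalence ; ∙-cong = cong₂ _⊕_ }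
              ; assoc = ⊕-assoc }
            ; identity = ⊕-identityˡ , ⊕-identityʳ }
          ; inverse = ⊝-inverseˡ , ⊝-inverseʳ
          ; ⁻¹-cong = cong ⊝_ }
        ; comm = ⊕-comm }
      ; *-cong = cong₂ _⊗_
      ; *-assoc = ⊗-assoc
      ; *-identity = ⊗-identityˡ , ⊗-identityʳ
      ; distrib = ⊗-distribˡ-⊕ , ⊗-distribʳ-⊕ }
    ; *-comm = ⊗-comm } }

open CommutativeRing ℚ[i]-commutativeRing using
  (commutativeSemiring; *-commutativeMonoid; *-commutativeSemigroup)
open Exp commutativeSemiring using () renaming
  (_^_ to _^ᴳ_; ^-homo-* to ^ᴳ-homo-*; ^-assocʳ to ^ᴳ-assocʳ)
open CommutativeMonoidSum *-commutativeMonoid using () renaming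
  (sum to ∏; sum-cong-≗ to ∏-cong; sum-init-last to ∏-init-last)
open CommutativeSemigroupProperties *-commutativeSemigroup using (interchange; x∙yz≈xz∙y)

_≟_ : DecidableEquality ℚ[i]
_≟_ = ≡-dec ℚ._≟_ ℚ._≟_

module ℚ[i]-Solver = RingSolver (ACR.fromCommutativeRing ℚ[i]-commutativeRing) _≟_
open ℚ[i]-Solver using () renaming
  (solve to solveᴳ; _:=_ to _:≡_; _:+_ to _:⊕_; _:*_ to _:⊗_; :-_ to :⊝_; con to conᴳ)

opaque
  unfolding _⊗_

  norm-nonNeg : ∀ z → 0ℚ ℚ.≤ norm z
  norm-nonNeg (x , y) = +-nonNeg (square-nonNeg x) (square-nonNeg y)

  norm-⊗ : ∀ z w → norm (z ⊗ w) ≡ norm z ℚ.* norm w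
  norm-⊗ (x , y) (u , v) = solve 4 (λ x y u v →
    (x :* u :+ :- (y :* v)) :* (x :* u :+ :- (y :* v)) :+
    (x :* v :+ y :* u) :* (x :* v :+ y :* u) :=
    (x :* x :+ y :* y) :* (u :* u :+ v :* v)) refl x y u v

  norm-⊝ : ∀ z → norm (⊝ z) ≡ norm z
  norm-⊝ (x , y) = solve 2 (λ x y → :- x :* :- x :+ :- y :* :- y := x :* x :+ y :* y) refl x y

  ⊗-inverseʳ : ∀ z → norm z ≢ 0ℚ → z ⊗ z ⁻¹ ≡ 𝟏
  ⊗-inverseʳ z@(x , y) N≢0 = cong₂ _,_
    (trans (solve 3 (λ x y i → x :* (x :* i) :+ :- (y :* (:- y :* i)) := (x :* x :+ y :* y) :* i)
      refl x y (inv (norm z))) (*-inv N≢0))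
    (solve 3 (λ x y i → x :* (:- y :* i) :+ y :* (x :* i) := con 0ℚ) refl x y (inv (norm z)))

  norm-⁻¹ : ∀ z → norm z ≢ 0ℚ → norm (z ⁻¹) ≡ inv (norm z)
  norm-⁻¹ z N≢0 = begin
    norm (z ⁻¹)                                ≡⟨ ℚ.*-identityˡ _ ⟨
    1ℚ ℚ.* norm (z ⁻¹)
      ≡⟨ cong (ℚ._* norm (z ⁻¹)) (trans (ℚ.*-comm (inv (norm z)) (norm z)) (*-inv N≢0)) ⟨
    inv (norm z) ℚ.* norm z ℚ.* norm (z ⁻¹)    ≡⟨ ℚ.*-assoc (inv (norm z)) (norm z) (norm (z ⁻¹)) ⟩
    inv (norm z) ℚ.* (norm z ℚ.* norm (z ⁻¹))  ≡⟨ cong (inv (norm z) ℚ.*_) (norm-⊗ z (z ⁻¹)) ⟨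
    inv (norm z) ℚ.* norm (z ⊗ z ⁻¹)           ≡⟨ cong (λ w → inv (norm z) ℚ.* norm w) (⊗-inverseʳ z N≢0) ⟩
    inv (norm z) ℚ.* 1ℚ                        ≡⟨ ℚ.*-identityʳ _ ⟩
    inv (norm z)                               ∎
    where open ≡-Reasoning

  -- Norms multiply to 1, so `norm z` cannot vanish and `z ⁻¹` is a true inverse. This evaluates the
  -- inverse of a whole product once a partner with product `𝟏` has been built factor by factor.
  ⁻¹-unique : ∀ z w → z ⊗ w ≡ 𝟏 → z ⁻¹ ≡ w
  ⁻¹-unique z w zw≡1 = begin
    z ⁻¹              ≡⟨ ⊗-identityʳ _ ⟨
    z ⁻¹ ⊗ 𝟏          ≡⟨ cong (z ⁻¹ ⊗_) zw≡1 ⟨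
    z ⁻¹ ⊗ (z ⊗ w)    ≡⟨ ⊗-assoc (z ⁻¹) z w ⟨
    z ⁻¹ ⊗ z ⊗ w      ≡⟨ cong (_⊗ w) (trans (⊗-comm (z ⁻¹) z) (⊗-inverseʳ z N≢0)) ⟩
    𝟏 ⊗ w             ≡⟨ ⊗-identityˡ w ⟩
    w                 ∎
    where
    open ≡-Reasoning
    N≢0 : norm z ≢ 0ℚ
    N≢0 N≡0 = contradiction
      (trans (sym (cong norm zw≡1)) (trans (norm-⊗ z w)
        (trans (cong (ℚ._* norm w) N≡0) (ℚ.*-zeroˡ (norm w))))) λ ()

-- Modulus bounds without square roots

infix 4 _≼_

-- z ≼ r means |z| ≤ r; norm is the squared modulus.
record _≼_ (z : ℚ[i]) (r : ℚ) : Set where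
  constructor _,_
  field
    nonNeg  : 0ℚ ℚ.≤ r
    bounded : norm z ℚ.≤ r ℚ.* r

open _≼_ public

≼-mono : ∀ {z r s} → z ≼ r → r ℚ.≤ s → z ≼ s
≼-mono (0≤r , z≤r) r≤s = 0≤s , ℚ.≤-trans z≤r (*-mono-≤ 0≤r 0≤s r≤s r≤s)
  where 0≤s = ℚ.≤-trans 0≤r r≤s

opaque
  unfolding _⊗_

  𝟎≼ : ∀ {r} → 0ℚ ℚ.≤ r → 𝟎 ≼ r
  𝟎≼ {r} 0≤r = 0≤r , square-nonNeg r

  𝟏≼1 : 𝟏 ≼ 1ℚ
  𝟏≼1 = 0≤1 , ℚ.≤-refl

⊝-≼ : ∀ {z r} → z ≼ r → ⊝ z ≼ r
⊝-≼ {z} {r} (0≤r , z≤r) = 0≤r , subst (ℚ._≤ r ℚ.* r) (sym (norm-⊝ z)) z≤r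

⊗-≼ : ∀ {z w r s} → z ≼ r → w ≼ s → z ⊗ w ≼ r ℚ.* s
⊗-≼ {z} {w} {r} {s} (0≤r , z≤r) (0≤s , w≤s) = *-nonNeg 0≤r 0≤s , subst₂ ℚ._≤_ (sym (norm-⊗ z w))
  (solve 2 (λ r s → (r :* r) :* (s :* s) := (r :* s) :* (r :* s)) refl r s)
  (*-mono-≤ (norm-nonNeg w) (square-nonNeg r) z≤r w≤s)

^-≼ : ∀ {z r} → z ≼ r → ∀ n → z ^ᴳ n ≼ r ^ℚ n
^-≼ z≼r zero    = 𝟏≼1
^-≼ z≼r (suc n) = ⊗-≼ z≼r (^-≼ z≼r n)

^-≼-antimono : ∀ {z r} → 0ℚ ℚ.≤ r → r ℚ.≤ 1ℚ → z ≼ r → ∀ {a n} → a ≤ n → z ^ᴳ n ≼ r ^ℚ a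
^-≼-antimono 0≤r r≤1 z≼r {n = n} a≤n = ≼-mono (^-≼ z≼r n) (^-antimono-≤ 0≤r r≤1 a≤n)

opaque
  unfolding _⊗_

  -- The triangle inequality. The mixed term `dot` is at most r s by Cauchy-Schwarz, which comes
  -- from Lagrange's identity dot² + cross² = norm z · norm w.
  ⊕-≼ : ∀ {z w r s} → z ≼ r → w ≼ s → z ⊕ w ≼ r ℚ.+ s
  ⊕-≼ {z@(x , y)} {w@(u , v)} {r} {s} (0≤r , z≤r) (0≤s , w≤s) = +-nonNeg 0≤r 0≤s , (begin
    norm (z ⊕ w)
      ≡⟨ solve 4 (λ x y u v → (x :+ u) :* (x :+ u) :+ (y :+ v) :* (y :+ v) :=
           (x :* x :+ y :* y) :+ (u :* u :+ v :* v) :+ ((x :* u :+ y :* v) :+ (x :* u :+ y :* v)))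
           refl x y u v ⟩
    norm z ℚ.+ norm w ℚ.+ (dot ℚ.+ dot)
      ≤⟨ ℚ.+-mono-≤ (ℚ.+-mono-≤ z≤r w≤s) (ℚ.+-mono-≤ dot≤rs dot≤rs) ⟩
    r ℚ.* r ℚ.+ s ℚ.* s ℚ.+ (r ℚ.* s ℚ.+ r ℚ.* s)
      ≡⟨ solve 2 (λ r s → r :* r :+ s :* s :+ (r :* s :+ r :* s) := (r :+ s) :* (r :+ s)) refl r s ⟩
    (r ℚ.+ s) ℚ.* (r ℚ.+ s) ∎)
    where
    open ℚ.≤-Reasoning
    dot cross : ℚ
    dot = x ℚ.* u ℚ.+ y ℚ.* v
    cross = x ℚ.* v ℚ.- y ℚ.* u

    dot≤rs : dot ℚ.≤ r ℚ.* s
    dot≤rs = square-cancel-≤ (*-nonNeg 0≤r 0≤s) (begin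
      dot ℚ.* dot
        ≤⟨ p≤p+q (square-nonNeg cross) ⟩
      dot ℚ.* dot ℚ.+ cross ℚ.* cross
        ≡⟨ solve 4 (λ x y u v →
             (x :* u :+ y :* v) :* (x :* u :+ y :* v) :+ (x :* v :- y :* u) :* (x :* v :- y :* u) :=
             (x :* x :+ y :* y) :* (u :* u :+ v :* v)) refl x y u v ⟩
      norm z ℚ.* norm w
        ≤⟨ *-mono-≤ (norm-nonNeg w) (square-nonNeg r) z≤r w≤s ⟩
      (r ℚ.* r) ℚ.* (s ℚ.* s)
        ≡⟨ solve 2 (λ r s → (r :* r) :* (s :* s) := (r :* s) :* (r :* s)) refl r s ⟩
      (r ℚ.* s) ℚ.* (r ℚ.* s) ∎)

  -- The real part suffices: it is at least 1 - r because |x| ≤ |z| ≤ r, and r ≤ 1 allows squaring.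
  norm-1⊕ : ∀ {z r} → z ≼ r → r ℚ.≤ 1ℚ → (1ℚ ℚ.- r) ℚ.* (1ℚ ℚ.- r) ℚ.≤ norm (𝟏 ⊕ z)
  norm-1⊕ {z@(x , y)} {r} (0≤r , z≤r) r≤1 = ℚ.≤-trans
    (*-mono-≤ (p≤q⇒0≤q-p r≤1) (ℚ.≤-trans (p≤q⇒0≤q-p r≤1) 1-r≤1+x) 1-r≤1+x 1-r≤1+x)
    (p≤p+q (square-nonNeg (0ℚ ℚ.+ y)))
    where
    open ℚ.≤-Reasoning
    -x≤r : ℚ.- x ℚ.≤ r
    -x≤r = square-cancel-≤ 0≤r (begin
      (ℚ.- x) ℚ.* (ℚ.- x)      ≡⟨ solve 1 (λ x → :- x :* :- x := x :* x) refl x ⟩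
      x ℚ.* x                  ≤⟨ p≤p+q (square-nonNeg y) ⟩
      norm z                   ≤⟨ z≤r ⟩
      r ℚ.* r                  ∎)

    1-r≤1+x : 1ℚ ℚ.- r ℚ.≤ 1ℚ ℚ.+ x
    1-r≤1+x = subst (1ℚ ℚ.- r ℚ.≤_) (cong (1ℚ ℚ.+_) (solve 1 (λ x → :- (:- x) := x) refl x))
      (ℚ.+-monoʳ-≤ 1ℚ (ℚ.neg-antimono-≤ -x≤r))

-- The natural bound is the square root of `inv δ`; `1ℚ ℚ.+ inv δ` dominates it and is rational.
⁻¹-≼ : ∀ {z δ} → 0ℚ ℚ.< δ → δ ℚ.≤ norm z → z ⁻¹ ≼ 1ℚ ℚ.+ inv δ
⁻¹-≼ {z} {δ} 0<δ δ≤N = +-nonNeg 0≤1 0≤inv , (begin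
  norm (z ⁻¹)                           ≡⟨ norm-⁻¹ z (pos⇒≢0 (ℚ.<-≤-trans 0<δ δ≤N)) ⟩
  inv (norm z)                          ≤⟨ inv-antimono-≤ 0<δ δ≤N ⟩
  inv δ                                 ≤⟨ p≤[1+p]² 0≤inv ⟩
  (1ℚ ℚ.+ inv δ) ℚ.* (1ℚ ℚ.+ inv δ)     ∎)
  where
  open ℚ.≤-Reasoning
  0≤inv = ℚ.<⇒≤ (inv-pos 0<δ)

-- The telescoping identity

∏-snoc : ∀ n (f : ℕ → ℚ[i]) →
  ∏ {suc n} (λ j → f (toℕ j)) ≡ ∏ {n} (λ j → f (toℕ j)) ⊗ f n
∏-snoc n f = trans (∏-init-last {n} (λ j → f (toℕ j)))
  (cong₂ _⊗_ (∏-cong {n} (λ j → cong f (Fin.toℕ-inject₁ j))) (cong f (Fin.toℕ-fromℕ n)))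

⊗-inverse-combine : ∀ {z z′ w w′} → z ⊗ z′ ≡ 𝟏 → w ⊗ w′ ≡ 𝟏 → (z ⊗ w) ⊗ (z′ ⊗ w′) ≡ 𝟏
⊗-inverse-combine {z} {z′} {w} {w′} zz′ ww′ = trans (interchange z w z′ w′)
  (trans (cong₂ _⊗_ zz′ ww′) (⊗-identityˡ 𝟏))

opaque
  unfolding _⊗_

  -- A common multiple of 1 + b y r = (1 - r) + r (1 + b y). It is applied with r = q^(m(n+1)), y =
  -- q^(x+1) and i = 1/(1 - r), so the first summand on the right loses its denominator 1 - r.
  telescoping-identity : ∀ X c i P b y r → X ⊗ (c ⊗ i) ⊗ (P ⊗ (𝟏 ⊕ b ⊗ (y ⊗ r))) ≡
    X ⊗ (c ⊗ ((𝟏 ⊕ ⊝ r) ⊗ i)) ⊗ P ⊕ r ⊗ X ⊗ (c ⊗ i) ⊗ (P ⊗ (𝟏 ⊕ b ⊗ y))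
  telescoping-identity = solveᴳ 7 (λ X c i P b y r →
    X :⊗ (c :⊗ i) :⊗ (P :⊗ (conᴳ 𝟏 :⊕ b :⊗ (y :⊗ r))) :≡
    X :⊗ (c :⊗ ((conᴳ 𝟏 :⊕ :⊝ r) :⊗ i)) :⊗ P :⊕ r :⊗ X :⊗ (c :⊗ i) :⊗ (P :⊗ (conᴳ 𝟏 :⊕ b :⊗ y))) refl

  1--bqz≡1+bqz : ∀ b q z → 𝟏 ⊕ ⊝ (⊝ (b ⊗ q) ⊗ z) ≡ 𝟏 ⊕ b ⊗ (q ⊗ z)
  1--bqz≡1+bqz = solveᴳ 3 (λ b q z →
    conᴳ 𝟏 :⊕ :⊝ (:⊝ (b :⊗ q) :⊗ z) :≡ conᴳ 𝟏 :⊕ b :⊗ (q :⊗ z)) refl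

module Series (m : ℕ) (q b : ℚ[i]) where

  d e : ℕ → ℚ[i]
  d N = 𝟏 ⊕ b ⊗ q ^ᴳ N
  e N = d N ⁻¹

  -- Π x l = ∏_{k=1}^{l} 1 / (1 + b q^(x+k))
  Π : ℕ → ℕ → ℚ[i]
  Π x zero    = 𝟏
  Π x (suc l) = e (suc x) ⊗ Π (suc x) l

  Π-+ : ∀ x l l′ → Π x (l ℕ.+ l′) ≡ Π x l ⊗ Π (x ℕ.+ l) l′
  Π-+ x zero    l′ = trans (cong (λ y → Π y l′) (sym (ℕ.+-identityʳ x))) (sym (⊗-identityˡ _))
  Π-+ x (suc l) l′ = begin
    e (suc x) ⊗ Π (suc x) (l ℕ.+ l′)                      ≡⟨ cong (e (suc x) ⊗_) (Π-+ (suc x) l l′) ⟩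
    e (suc x) ⊗ (Π (suc x) l ⊗ Π (suc x ℕ.+ l) l′)        ≡⟨ ⊗-assoc _ _ _ ⟨
    e (suc x) ⊗ Π (suc x) l ⊗ Π (suc x ℕ.+ l) l′
      ≡⟨ cong (λ y → e (suc x) ⊗ Π (suc x) l ⊗ Π y l′) (ℕ.+-suc x l) ⟨
    e (suc x) ⊗ Π (suc x) l ⊗ Π (x ℕ.+ suc l) l′          ∎
    where open ≡-Reasoning

  Π-snoc : ∀ x l → Π x (suc l) ≡ Π x l ⊗ e (suc (x ℕ.+ l))
  Π-snoc x l = trans (cong (Π x) (sym (ℕ.+-comm l 1)))
    (trans (Π-+ x l 1) (cong (Π x l ⊗_) (⊗-identityʳ _)))

  -- The reciprocal of (q^m; q^m)ₙ when its factors are invertible.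
  c : ℕ → ℚ[i]
  c zero    = 𝟏
  c (suc n) = c n ⊗ (𝟏 ⊕ ⊝ q ^ᴳ (m ℕ.* suc n)) ⁻¹

  -- The reciprocal of the denominator with b replaced by b q^s. Passing to the tail raises `s` by m
  -- + 1, which absorbs the summand j(m + 1) of the exponent and makes the product recursive in the
  -- tuple.
  weight : ∀ {n} → ℕ → Vec ℕ n → ℚ[i]
  weight s []      = 𝟏
  weight s (a ∷ v) = Π (s ℕ.+ a) (suc m) ⊗ weight (s ℕ.+ suc m) v

  term : ∀ {n} → ℕ → Vec ℕ n → ℚ[i]
  term s v = q ^ᴳ (m ℕ.* Vec.sum v) ⊗ weight s v

  -- The factor u(a) contributed by the first entry.
  head-factor : ℕ → ℕ → ℚ[i]
  head-factor s a = q ^ᴳ (m ℕ.* a) ⊗ Π (s ℕ.+ a) (suc m)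

  term-∷ : ∀ {n} s a (v : Vec ℕ n) → term s (a ∷ v) ≡ head-factor s a ⊗ term (s ℕ.+ suc m) v
  term-∷ s a v = trans
    (cong (_⊗ weight s (a ∷ v)) (trans (cong (q ^ᴳ_) (ℕ.*-distribˡ-+ m a (Vec.sum v)))
      (^ᴳ-homo-* q (m ℕ.* a) (m ℕ.* Vec.sum v))))
    (interchange (q ^ᴳ (m ℕ.* a)) (q ^ᴳ (m ℕ.* Vec.sum v)) (Π (s ℕ.+ a) (suc m)) (weight (s ℕ.+ suc m) v))

  -- The sum of term s over all weakly increasing v with entries ≥ A.
  closed : ℕ → ℕ → ℕ → ℚ[i]
  closed s n A = q ^ᴳ (m ℕ.* n ℕ.* A) ⊗ c n ⊗ Π (s ℕ.+ A) (m ℕ.* n)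

  module _ (d⊗e : ∀ N → 1 ℕ.≤ N → d N ⊗ e N ≡ 𝟏)
           (1-q^-inverse : ∀ n → (𝟏 ⊕ ⊝ q ^ᴳ (m ℕ.* suc n)) ⊗ (𝟏 ⊕ ⊝ q ^ᴳ (m ℕ.* suc n)) ⁻¹ ≡ 𝟏) where

    -- All three terms are compared with `P`, a product of M + 1 consecutive reciprocals. The left
    -- side lacks the last of them, the closed form at A + 1 lacks the first, and the term of the
    -- first entry A uses all: m + 1 in its head factor and m n in the closed form for the tail.
    closed-telescopes : ∀ s n A → closed s (suc n) A ≡
      head-factor s A ⊗ closed (s ℕ.+ suc m) n A ⊕ closed s (suc n) (suc A)
    closed-telescopes s n A = begin
      X ⊗ c′ ⊗ Π x M
        ≡⟨ cong (X ⊗ c′ ⊗_) ΠxM ⟩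
      X ⊗ c′ ⊗ (P ⊗ (𝟏 ⊕ b ⊗ (y ⊗ r)))
        ≡⟨ telescoping-identity X (c n) i P b y r ⟩
      X ⊗ (c n ⊗ ((𝟏 ⊕ ⊝ r) ⊗ i)) ⊗ P ⊕ r ⊗ X ⊗ c′ ⊗ (P ⊗ (𝟏 ⊕ b ⊗ y))
        ≡⟨ cong₂ _⊕_ first second ⟩
      head-factor s A ⊗ closed (s ℕ.+ suc m) n A ⊕ closed s (suc n) (suc A) ∎
      where
      open ≡-Reasoning
      M = m ℕ.* suc n
      x = s ℕ.+ A
      X = q ^ᴳ (M ℕ.* A)
      r = q ^ᴳ M
      y = q ^ᴳ suc x
      c′ = c (suc n)
      i = (𝟏 ⊕ ⊝ r) ⁻¹
      P = Π x (suc M)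

      undo : ∀ z {w w′} → w ⊗ w′ ≡ 𝟏 → z ≡ (z ⊗ w′) ⊗ w
      undo z {w} {w′} ww′ = trans (sym (⊗-identityʳ z)) (trans (cong (z ⊗_) (sym ww′))
        (x∙yz≈xz∙y z w w′))

      ΠxM : Π x M ≡ P ⊗ (𝟏 ⊕ b ⊗ (y ⊗ r))
      ΠxM = trans (undo (Π x M) (d⊗e (suc (x ℕ.+ M)) (ℕ.s≤s ℕ.z≤n)))
        (cong₂ _⊗_ (sym (Π-snoc x M)) (cong (λ z → 𝟏 ⊕ b ⊗ z) (^ᴳ-homo-* q (suc x) M)))

      first : X ⊗ (c n ⊗ ((𝟏 ⊕ ⊝ r) ⊗ i)) ⊗ P ≡ head-factor s A ⊗ closed (s ℕ.+ suc m) n A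
      first = begin
        X ⊗ (c n ⊗ ((𝟏 ⊕ ⊝ r) ⊗ i)) ⊗ P
          ≡⟨ cong (λ z → X ⊗ z ⊗ P) (trans (cong (c n ⊗_) (1-q^-inverse n)) (⊗-identityʳ (c n))) ⟩
        X ⊗ c n ⊗ P
          ≡⟨ cong₂ (λ z w → z ⊗ c n ⊗ w)
               (trans (cong (q ^ᴳ_) exponent) (^ᴳ-homo-* q (m ℕ.* A) (m ℕ.* n ℕ.* A)))
               (trans (cong (λ l → Π x (suc l)) (ℕ.*-suc m n)) (Π-+ x (suc m) (m ℕ.* n))) ⟩
        (q ^ᴳ (m ℕ.* A) ⊗ q ^ᴳ (m ℕ.* n ℕ.* A)) ⊗ c n ⊗ (Π x (suc m) ⊗ Π (x ℕ.+ suc m) (m ℕ.* n))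
          ≡⟨ trans (cong (_⊗ (Π x (suc m) ⊗ Π (x ℕ.+ suc m) (m ℕ.* n))) (⊗-assoc _ _ _)) (interchange _ _ _ _) ⟩
        head-factor s A ⊗ (q ^ᴳ (m ℕ.* n ℕ.* A) ⊗ c n ⊗ Π (x ℕ.+ suc m) (m ℕ.* n))
          ≡⟨ cong (λ z → head-factor s A ⊗ (q ^ᴳ (m ℕ.* n ℕ.* A) ⊗ c n ⊗ Π z (m ℕ.* n))) reindex ⟩
        head-factor s A ⊗ closed (s ℕ.+ suc m) n A ∎
        where
        exponent : M ℕ.* A ≡ m ℕ.* A ℕ.+ m ℕ.* n ℕ.* A
        exponent = trans (cong (ℕ._* A) (ℕ.*-suc m n)) (ℕ.*-distribʳ-+ A m (m ℕ.* n))

        reindex : x ℕ.+ suc m ≡ s ℕ.+ suc m ℕ.+ A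
        reindex = trans (ℕ.+-assoc s A (suc m))
          (trans (cong (s ℕ.+_) (ℕ.+-comm A (suc m))) (sym (ℕ.+-assoc s (suc m) A)))

      second : r ⊗ X ⊗ c′ ⊗ (P ⊗ (𝟏 ⊕ b ⊗ y)) ≡ closed s (suc n) (suc A)
      second = cong₂ (λ z w → z ⊗ c′ ⊗ w)
        (trans (sym (^ᴳ-homo-* q M (M ℕ.* A))) (cong (q ^ᴳ_) (sym (ℕ.*-suc M A))))
        (trans (cong (_⊗ (𝟏 ⊕ b ⊗ y)) (⊗-comm (e (suc x)) (Π (suc x) M)))
          (trans (sym (undo (Π (suc x) M) (d⊗e (suc x) (ℕ.s≤s ℕ.z≤n))))
            (cong (λ z → Π z M) (sym (ℕ.+-suc s A)))))

    ∏d⊗Π : ∀ x l → ∏ {l} (λ k → d (x ℕ.+ suc (toℕ k))) ⊗ Π x l ≡ 𝟏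
    ∏d⊗Π x zero    = ⊗-identityˡ 𝟏
    ∏d⊗Π x (suc l) = ⊗-inverse-combine
      (trans (cong (λ y → d y ⊗ e (suc x)) (ℕ.+-comm x 1)) (d⊗e (suc x) (ℕ.s≤s ℕ.z≤n)))
      (trans (cong (_⊗ Π (suc x) l) (∏-cong {l} (λ k → cong d (ℕ.+-suc x (suc (toℕ k))))))
        (∏d⊗Π (suc x) l))

    den : ∀ {n} → ℕ → Vec ℕ n → ℚ[i]
    den {n} s v = ∏ {n} λ j → ∏ {suc m} λ k →
      d (s ℕ.+ (toℕ j ℕ.* suc m ℕ.+ suc (toℕ k) ℕ.+ Vec.lookup v j))

    -- Row j = 0 of the double product is inverted by the first block of `weight`; the later rows
    -- form the denominator of the tail with offset s + m + 1.
    den⊗weight : ∀ {n} s (v : Vec ℕ n) → den s v ⊗ weight s v ≡ 𝟏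
    den⊗weight s []              = ⊗-identityˡ 𝟏
    den⊗weight {suc n} s (a ∷ v) = ⊗-inverse-combine
      (trans (cong (_⊗ Π (s ℕ.+ a) (suc m)) (∏-cong {suc m} λ k → cong d (headIndex (toℕ k))))
        (∏d⊗Π (s ℕ.+ a) (suc m)))
      (trans (cong (_⊗ weight (s ℕ.+ suc m) v)
          (∏-cong {n} λ j → ∏-cong {suc m} λ k → cong d (tailIndex (toℕ j) (toℕ k) (Vec.lookup v j))))
        (den⊗weight (s ℕ.+ suc m) v))
      where
      headIndex : ∀ k → s ℕ.+ (suc k ℕ.+ a) ≡ s ℕ.+ a ℕ.+ suc k
      headIndex k = trans (cong (s ℕ.+_) (ℕ.+-comm (suc k) a)) (sym (ℕ.+-assoc s a (suc k)))

      tailIndex : ∀ j k a → s ℕ.+ (suc j ℕ.* suc m ℕ.+ suc k ℕ.+ a) ≡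
                            s ℕ.+ suc m ℕ.+ (j ℕ.* suc m ℕ.+ suc k ℕ.+ a)
      tailIndex j k a = trans
        (cong (s ℕ.+_) (trans (cong (ℕ._+ a) (ℕ.+-assoc (suc m) (j ℕ.* suc m) (suc k)))
          (ℕ.+-assoc (suc m) (j ℕ.* suc m ℕ.+ suc k) a)))
        (sym (ℕ.+-assoc s (suc m) (j ℕ.* suc m ℕ.+ suc k ℕ.+ a)))

    q-pochhammer⊗c : ∀ n → ∏ {n} (λ j → 𝟏 ⊕ ⊝ (q ^ᴳ m ⊗ (q ^ᴳ m) ^ᴳ toℕ j)) ⊗ c n ≡ 𝟏
    q-pochhammer⊗c zero    = ⊗-identityˡ 𝟏
    q-pochhammer⊗c (suc n) = trans
      (cong (_⊗ c (suc n)) (∏-snoc n (λ j → 𝟏 ⊕ ⊝ (q ^ᴳ m ⊗ (q ^ᴳ m) ^ᴳ j))))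
      (⊗-inverse-combine {w = 𝟏 ⊕ ⊝ (q ^ᴳ m ⊗ (q ^ᴳ m) ^ᴳ n)} (q-pochhammer⊗c n)
        (trans (cong (λ z → (𝟏 ⊕ ⊝ z) ⊗ (𝟏 ⊕ ⊝ q ^ᴳ (m ℕ.* suc n)) ⁻¹) (^ᴳ-assocʳ q m (suc n))) (1-q^-inverse n)))

    bq-pochhammer⊗Π : ∀ l → ∏ {l} (λ j → 𝟏 ⊕ ⊝ (⊝ (b ⊗ q) ⊗ q ^ᴳ toℕ j)) ⊗ Π 0 l ≡ 𝟏
    bq-pochhammer⊗Π l = trans (cong (_⊗ Π 0 l) (∏-cong {l} λ j →
        1--bqz≡1+bqz b q (q ^ᴳ toℕ j)))
      (∏d⊗Π 0 l)

    term-value : ∀ {n} (v : Vec ℕ n) → q ^ᴳ (m ℕ.* Vec.sum v) ⊗ den 0 v ⁻¹ ≡ term 0 v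
    term-value v = cong (q ^ᴳ (m ℕ.* Vec.sum v) ⊗_) (⁻¹-unique (den 0 v) (weight 0 v) (den⊗weight 0 v))

    closed-value : ∀ n → 𝟏 ⊗ (∏ {n} (λ j → 𝟏 ⊕ ⊝ (q ^ᴳ m ⊗ (q ^ᴳ m) ^ᴳ toℕ j)) ⊗
      ∏ {m ℕ.* n} (λ j → 𝟏 ⊕ ⊝ (⊝ (b ⊗ q) ⊗ q ^ᴳ toℕ j))) ⁻¹ ≡ closed 0 n 0
    closed-value n = begin
      𝟏 ⊗ _ ⁻¹
        ≡⟨ cong (𝟏 ⊗_) (⁻¹-unique _ (c n ⊗ Π 0 (m ℕ.* n))
             (⊗-inverse-combine (q-pochhammer⊗c n) (bq-pochhammer⊗Π (m ℕ.* n)))) ⟩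
      𝟏 ⊗ (c n ⊗ Π 0 (m ℕ.* n))
        ≡⟨ ⊗-assoc _ _ _ ⟨
      𝟏 ⊗ c n ⊗ Π 0 (m ℕ.* n)
        ≡⟨ cong (λ k → q ^ᴳ k ⊗ c n ⊗ Π 0 (m ℕ.* n)) (ℕ.*-zeroʳ (m ℕ.* n)) ⟨
      q ^ᴳ (m ℕ.* n ℕ.* 0) ⊗ c n ⊗ Π 0 (m ℕ.* n)      ∎
      where open ≡-Reasoning

-- Weakly increasing tuples

module ListSum {C : Set} {_⊞_ _⊡_ : Op₂ C} {0# 1# : C}
               (isCommutativeSemiring : IsCommutativeSemiring _≡_ _⊞_ _⊡_ 0# 1#) where

  open IsCommutativeSemiring isCommutativeSemiring using
    (+-identityˡ; +-assoc; +-isCommutativeMonoid; zeroʳ; distribˡ)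

  ∑ : {I : Set} → (I → C) → List I → C
  ∑ f L = List.foldr _⊞_ 0# (List.map f L)

  ∑-++ : ∀ {I : Set} (f : I → C) L L′ → ∑ f (L ++ L′) ≡ ∑ f L ⊞ ∑ f L′
  ∑-++ f []      L′ = sym (+-identityˡ (∑ f L′))
  ∑-++ f (x ∷ L) L′ = trans (cong (f x ⊞_) (∑-++ f L L′)) (sym (+-assoc (f x) (∑ f L) (∑ f L′)))

  ∑-↭ : ∀ {I : Set} (f : I → C) {L L′} → L ↭ L′ → ∑ f L ≡ ∑ f L′
  ∑-↭ f L↭L′ = ↭ₛ.foldr-commMonoid (setoid C) +-isCommutativeMonoid (↭⇒↭ₛ (↭-map⁺ f L↭L′))

  ∑-map : ∀ {I J : Set} (f : J → C) (g : I → J) L → ∑ f (List.map g L) ≡ ∑ (λ i → f (g i)) L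
  ∑-map f g L = cong (List.foldr _⊞_ 0#) (sym (List.map-∘ L))

  ∑-cong : ∀ {I : Set} {f g : I → C} → (∀ i → f i ≡ g i) → ∀ L → ∑ f L ≡ ∑ g L
  ∑-cong f≗g L = cong (List.foldr _⊞_ 0#) (List.map-cong f≗g L)

  *-distribˡ-∑ : ∀ {I : Set} c (f : I → C) L → ∑ (λ i → c ⊡ f i) L ≡ c ⊡ ∑ f L
  *-distribˡ-∑ c f []      = sym (zeroʳ c)
  *-distribˡ-∑ c f (x ∷ L) = trans (cong ((c ⊡ f x) ⊞_) (*-distribˡ-∑ c f L)) (sym (distribˡ c (f x) (∑ f L)))

∈-↭-head : ∀ {A : Set} {x : A} {L} → x ∈ L → ∃[ L′ ] L ↭ x ∷ L′
∈-↭-head x∈L with ys , zs , refl ← ∈-∃++ x∈L = ys ++ zs , shift _ ys zs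

-- Each element of V is moved to the front of W and removed; as V has no repetition, its other
-- elements remain in what is left of W. This splits an arbitrary large index set into the tuples
-- with bounded entries and a remainder.
⊆⇒↭-++ : ∀ {A : Set} {V W : List A} → Unique V → V ⊆ W → ∃[ R ] W ↭ V ++ R
⊆⇒↭-++ {V = []}    {W} _         _   = W , ↭-refl
⊆⇒↭-++ {V = x ∷ V} {W} (x∉V ∷ u) V⊆W =
  let W′ , W↭x∷W′ = ∈-↭-head (V⊆W (here refl))
      R , W′↭V++R = ⊆⇒↭-++ u (V⊆W′ W↭x∷W′)
  in R , ↭-trans W↭x∷W′ (prep x W′↭V++R)
  where
  V⊆W′ : ∀ {W′} → W ↭ x ∷ W′ → V ⊆ W′
  V⊆W′ W↭ v∈V with ∈-resp-↭ W↭ (V⊆W (there v∈V))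
  ... | here v≡x   = contradiction (sym v≡x) (All.lookup x∉V v∈V)
  ... | there v∈W′ = v∈W′

Unique-++⁻ : ∀ {A : Set} (V : List A) {R} → Unique (V ++ R) → Unique R × Disjoint V R
Unique-++⁻ []      u          = u , λ ()
Unique-++⁻ (x ∷ V) (x∉ ∷ u) with uR , disj ← Unique-++⁻ V u = uR , λ where
  (here refl , v∈R) → All.lookup x∉ (∈-++⁺ʳ V v∈R) refl
  (there v∈V , v∈R) → disj (v∈V , v∈R)

-- The tuples with A ≤ a₁ ≤ … ≤ aₙ < A + k.
chains : ∀ n → ℕ → ℕ → List (Vec ℕ n)
chains zero    A k       = [] ∷ []
chains (suc n) A zero    = []
chains (suc n) A (suc k) = List.map (A ∷_) (chains n A (suc k)) ++ chains (suc n) (suc A) k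

Linked-suc : ∀ {n A} {v : Vec ℕ n} → Linked _≤_ (suc A ∷ v) → Linked _≤_ (A ∷ v)
Linked-suc [-]       = [-]
Linked-suc (A<a ∷ l) = ℕ.<⇒≤ A<a ∷ l

chains-linked : ∀ n A k → All (λ v → Linked _≤_ (A ∷ v)) (chains n A k)
chains-linked zero    A k       = [-] ∷ []
chains-linked (suc n) A zero    = []
chains-linked (suc n) A (suc k) = All.++⁺
  (All.map⁺ (All.map (ℕ.≤-refl ∷_) (chains-linked n A (suc k))))
  (All.map Linked-suc (chains-linked (suc n) (suc A) k))

chains-unique : ∀ n A k → Unique (chains n A k)
chains-unique zero    A k       = [] ∷ []
chains-unique (suc n) A zero    = []
chains-unique (suc n) A (suc k) = Unique.++⁺
  (Unique.map⁺ Vec.∷-injectiveʳ (chains-unique n A (suc k)))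
  (chains-unique (suc n) (suc A) k)
  λ (v∈ , v∈′) → disjoint v∈ v∈′
  where
  disjoint : ∀ {v} → v ∈ List.map (A ∷_) (chains n A (suc k)) → v ∈ chains (suc n) (suc A) k → _
  disjoint v∈ v∈′ with _ , _ , refl ← ∈-map⁻ (A ∷_) v∈
    with A<A ∷ _ ← All.lookup (chains-linked (suc n) (suc A) k) v∈′ = ℕ.<-irrefl refl A<A

-- A tuple that is not listed has an entry of at least A + k. The conclusion records its sum, since
-- that is the quantity controlling the size of its term.
chains-complete : ∀ {n} A k (v : Vec ℕ n) → Linked _≤_ (A ∷ v) → v ∈ chains n A k ⊎ A ℕ.+ k ≤ Vec.sum v
chains-complete A k       []      l         = inj₁ (here refl)
chains-complete A zero    (a ∷ v) (A≤a ∷ l) =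
  inj₂ (ℕ.≤-trans (ℕ.≤-reflexive (ℕ.+-identityʳ A)) (ℕ.≤-trans A≤a (ℕ.m≤m+n a (Vec.sum v))))
chains-complete {suc n} A (suc k) (a ∷ v) (A≤a ∷ l) with ℕ.m≤n⇒m<n∨m≡n A≤a
-- A first entry above A moves the lower end of the window up and keeps the upper end A + k; a first
-- entry equal to A is stripped and the tail is checked in the same window.
... | inj₁ A<a  = Sum.map (∈-++⁺ʳ (List.map (A ∷_) (chains n A (suc k))))
                    (ℕ.≤-trans (ℕ.≤-reflexive (ℕ.+-suc A k))) (chains-complete (suc A) k (a ∷ v) (A<a ∷ l))
... | inj₂ refl = Sum.map (λ v∈ → ∈-++⁺ˡ (∈-map⁺ (A ∷_) v∈))
                    (λ A+k≤ → ℕ.≤-trans A+k≤ (ℕ.m≤n+m (Vec.sum v) A)) (chains-complete A (suc k) v l)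

-- Geometric majorants for sums over weakly increasing tuples

module ℚ∑ = ListSum (CommutativeRing.isCommutativeSemiring ℚ.+-*-commutativeRing)
open ℚ∑ using () renaming (∑ to ∑ℚ)

∑ℚ-nonNeg : ∀ {I : Set} {f : I → ℚ} → (∀ i → 0ℚ ℚ.≤ f i) → ∀ L → 0ℚ ℚ.≤ ∑ℚ f L
∑ℚ-nonNeg 0≤f []      = ℚ.≤-refl
∑ℚ-nonNeg 0≤f (x ∷ L) = +-nonNeg (0≤f x) (∑ℚ-nonNeg 0≤f L)

∑ℚ-⊆ : ∀ {I : Set} {f : I → ℚ} → (∀ i → 0ℚ ℚ.≤ f i) → ∀ {L L′} →
  Unique L → L ⊆ L′ → ∑ℚ f L ℚ.≤ ∑ℚ f L′
∑ℚ-⊆ {f = f} 0≤f {L} {L′} u L⊆L′ =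
  let R , L′↭L++R = ⊆⇒↭-++ u L⊆L′
  in ℚ.≤-trans (p≤p+q (∑ℚ-nonNeg 0≤f R))
       (ℚ.≤-reflexive (trans (sym (ℚ∑.∑-++ f L R)) (ℚ∑.∑-↭ f (↭-sym L′↭L++R))))

module Geometric {t h : ℚ} (0≤t : 0ℚ ℚ.≤ t) (t≤1 : t ℚ.≤ 1ℚ) (0≤h : 0ℚ ℚ.≤ h)
                 ([1-t]h≡1 : (1ℚ ℚ.- t) ℚ.* h ≡ 1ℚ) where

  -- The equation 1 + t h = h of the geometric series, scaled by x.
  h-step : ∀ x → x ℚ.+ t ℚ.* x ℚ.* h ≡ x ℚ.* h
  h-step x = trans (cong (ℚ._+ t ℚ.* x ℚ.* h) (trans (sym (ℚ.*-identityʳ x)) (cong (x ℚ.*_) (sym [1-t]h≡1))))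
    (solve 3 (λ t h x → x :* ((con 1ℚ :- t) :* h) :+ t :* x :* h := x :* h) refl t h x)

  t^-nonNeg : ∀ n → 0ℚ ℚ.≤ t ^ℚ n
  t^-nonNeg = ^-nonNeg 0≤t

  t^sum : ∀ {n} → Vec ℕ n → ℚ
  t^sum v = t ^ℚ Vec.sum v

  mutual
    ∑-chains : ∀ n A k → ∑ℚ t^sum (chains n A k) ℚ.≤ h ^ℚ n
    ∑-chains zero    A k = ℚ.≤-reflexive (ℚ.+-identityʳ 1ℚ)
    ∑-chains (suc n) A k = ℚ.≤-trans (∑-chains-suc n A k)
      (ℚ.≤-trans (*-monoʳ-≤ (^-nonNeg 0≤h (suc n)) (^-≤1 0≤t t≤1 A)) (ℚ.≤-reflexive (ℚ.*-identityˡ _)))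

    -- Tuples starting with A contribute at most t^A hⁿ and the others at most t^(A+1) h^(n+1);
    -- `h-step` adds these up. The factor t^A exists only for nonempty tuples, so tails are bounded
    -- through the coarser `∑-chains`.
    ∑-chains-suc : ∀ n A k → ∑ℚ t^sum (chains (suc n) A k) ℚ.≤ t ^ℚ A ℚ.* h ^ℚ suc n
    ∑-chains-suc n A zero    = *-nonNeg (t^-nonNeg A) (^-nonNeg 0≤h (suc n))
    ∑-chains-suc n A (suc k) = begin
      ∑ℚ t^sum (List.map (A ∷_) L ++ L′)
        ≡⟨ ℚ∑.∑-++ t^sum (List.map (A ∷_) L) L′ ⟩
      ∑ℚ t^sum (List.map (A ∷_) L) ℚ.+ ∑ℚ t^sum L′
        ≡⟨ cong (ℚ._+ ∑ℚ t^sum L′) (trans (ℚ∑.∑-map t^sum (A ∷_) L)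
             (trans (ℚ∑.∑-cong (λ v → ^ℚ-homo-* t A (Vec.sum v)) L) (ℚ∑.*-distribˡ-∑ (t ^ℚ A) t^sum L))) ⟩
      t ^ℚ A ℚ.* ∑ℚ t^sum L ℚ.+ ∑ℚ t^sum L′
        ≤⟨ ℚ.+-mono-≤ (*-monoˡ-≤ (t^-nonNeg A) (∑-chains n A (suc k))) (∑-chains-suc n (suc A) k) ⟩
      t ^ℚ A ℚ.* h ^ℚ n ℚ.+ t ℚ.* t ^ℚ A ℚ.* (h ℚ.* h ^ℚ n)
        ≡⟨ solve 4 (λ t h a c → a :* c :+ t :* a :* (h :* c) := a :* c :+ t :* (a :* c) :* h)
             refl t h (t ^ℚ A) (h ^ℚ n) ⟩
      t ^ℚ A ℚ.* h ^ℚ n ℚ.+ t ℚ.* (t ^ℚ A ℚ.* h ^ℚ n) ℚ.* h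
        ≡⟨ h-step (t ^ℚ A ℚ.* h ^ℚ n) ⟩
      t ^ℚ A ℚ.* h ^ℚ n ℚ.* h
        ≡⟨ solve 3 (λ a b c → a :* b :* c := a :* (c :* b)) refl (t ^ℚ A) (h ^ℚ n) h ⟩
      t ^ℚ A ℚ.* h ^ℚ suc n ∎
      where
      open ℚ.≤-Reasoning
      L = chains n A (suc k)
      L′ = chains (suc n) (suc A) k

  ∑-linked : ∀ {n} (R : List (Vec ℕ n)) → Unique R → All (λ v → Linked _≤_ (0 ∷ v)) R → ∑ℚ t^sum R ℚ.≤ h ^ℚ n
  ∑-linked {n} R u linked = ℚ.≤-trans (∑ℚ-⊆ (λ v → t^-nonNeg (Vec.sum v)) u R⊆chains) (∑-chains n 0 K)
    where
    -- Larger than every sum of entries occurring in R, which rules out the second alternative of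
    -- `chains-complete`.
    K = suc (Extrema.max 0 (List.map Vec.sum R))

    R⊆chains : R ⊆ chains n 0 K
    R⊆chains {v} v∈R with chains-complete 0 K v (All.lookup linked v∈R)
    ... | inj₁ v∈ = v∈
    ... | inj₂ K≤ = contradiction (All.lookup (All.map⁻ (Extrema.xs≤max 0 (List.map Vec.sum R))) v∈R) (ℕ.<⇒≱ K≤)

-- Error estimates

module ℚ[i]∑ = ListSum (CommutativeRing.isCommutativeSemiring ℚ[i]-commutativeRing)
open ℚ[i]∑ using (∑)

∑-≼ : ∀ {I : Set} {f : I → ℚ[i]} {g : I → ℚ} {L} → All (λ i → f i ≼ g i) L → ∑ f L ≼ ∑ℚ g L
∑-≼ []         = 𝟎≼ ℚ.≤-refl
∑-≼ (f≼ ∷ f≼s) = ⊕-≼ f≼ (∑-≼ f≼s)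

opaque
  unfolding _⊗_

  error-split : ∀ u a a′ b b′ → (u ⊗ a ⊕ b) ⊕ ⊝ (u ⊗ a′ ⊕ b′) ≡ u ⊗ (a ⊕ ⊝ a′) ⊕ (b ⊕ ⊝ b′)
  error-split = solveᴳ 5 (λ u a a′ b b′ →
    (u :⊗ a :⊕ b) :⊕ :⊝ (u :⊗ a′ :⊕ b′) :≡ u :⊗ (a :⊕ :⊝ a′) :⊕ (b :⊕ :⊝ b′)) refl

  error-+ : ∀ a b c → (a ⊕ b) ⊕ ⊝ c ≡ (a ⊕ ⊝ c) ⊕ b
  error-+ = solveᴳ 3 (λ a b c → (a :⊕ b) :⊕ :⊝ c :≡ (a :⊕ :⊝ c) :⊕ b) refl

-- G bounds 1/(1 + b q^N), H bounds 1/(1 - q^M), and h is the sum of the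
-- geometric series with ratio t.
module Constants (m : ℕ) (t δ : ℚ) where

  h G H : ℚ
  h = inv (1ℚ ℚ.- t)
  G = 1ℚ ℚ.+ inv δ
  H = 1ℚ ℚ.+ inv ((1ℚ ℚ.- t) ℚ.* (1ℚ ℚ.- t))

  weightBound : ℚ
  weightBound = G ^ℚ suc m

  closedBound : ℕ → ℚ
  closedBound n = H ^ℚ n ℚ.* G ^ℚ (m ℕ.* n)

  -- For n = 0 the partial sum is exact. Otherwise the first summand pays for the closed form left
  -- over once the window is empty, and the second for the errors of the tail sums, added
  -- geometrically over the first entry.
  chainsBound : ℕ → ℚ
  chainsBound zero    = 0ℚ
  chainsBound (suc n) = closedBound (suc n) ℚ.+ weightBound ℚ.* chainsBound n ℚ.* h

  -- The error on the listed tuples plus the contribution of all further ones.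
  totalBound : ℕ → ℚ
  totalBound n = chainsBound n ℚ.+ weightBound ^ℚ n ℚ.* h ^ℚ n

  module _ (t<1 : t ℚ.< 1ℚ) (0<δ : 0ℚ ℚ.< δ) where

    0<1-t : 0ℚ ℚ.< 1ℚ ℚ.- t
    0<1-t = p<q⇒0<q-p t<1

    h-nonNeg : 0ℚ ℚ.≤ h
    h-nonNeg = ℚ.<⇒≤ (inv-pos 0<1-t)

    G-nonNeg : 0ℚ ℚ.≤ G
    G-nonNeg = +-nonNeg 0≤1 (ℚ.<⇒≤ (inv-pos 0<δ))

    H-nonNeg : 0ℚ ℚ.≤ H
    H-nonNeg = +-nonNeg 0≤1 (ℚ.<⇒≤ (inv-pos (*-pos 0<1-t 0<1-t)))

    weightBound-nonNeg : 0ℚ ℚ.≤ weightBound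
    weightBound-nonNeg = ^-nonNeg G-nonNeg (suc m)

    chainsBound-nonNeg : ∀ n → 0ℚ ℚ.≤ chainsBound n
    chainsBound-nonNeg zero    = ℚ.≤-refl
    chainsBound-nonNeg (suc n) = +-nonNeg (*-nonNeg (^-nonNeg H-nonNeg (suc n)) (^-nonNeg G-nonNeg (m ℕ.* suc n)))
      (*-nonNeg (*-nonNeg weightBound-nonNeg (chainsBound-nonNeg n)) h-nonNeg)

    totalBound-nonNeg : ∀ n → 0ℚ ℚ.≤ totalBound n
    totalBound-nonNeg n = +-nonNeg (chainsBound-nonNeg n)
      (*-nonNeg (^-nonNeg weightBound-nonNeg n) (^-nonNeg h-nonNeg n))

-- The error of partial sums for fixed Gaussian rationals

module Estimate
  (m : ℕ) .{{_ : NonZero m}} (q b : ℚ[i]) {t δ : ℚ}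
  (0≤t : 0ℚ ℚ.≤ t) (t<1 : t ℚ.< 1ℚ) (q≼t² : q ≼ t ℚ.* t)
  (0<δ : 0ℚ ℚ.< δ) (δ≤∣1+bq^N∣² : ∀ N → 1 ≤ N → δ ℚ.≤ norm (𝟏 ⊕ b ⊗ q ^ᴳ N))
  where

  open Series m q b
  open Constants m t δ

  t≤1 : t ℚ.≤ 1ℚ
  t≤1 = ℚ.<⇒≤ t<1

  0≤h : 0ℚ ℚ.≤ h
  0≤h = h-nonNeg t<1 0<δ

  0≤D : 0ℚ ℚ.≤ weightBound
  0≤D = weightBound-nonNeg t<1 0<δ

  open Geometric 0≤t t≤1 0≤h (*-inv (pos⇒≢0 (0<1-t t<1 0<δ)))

  d⊗e : ∀ N → 1 ≤ N → d N ⊗ e N ≡ 𝟏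
  d⊗e N 1≤N = ⊗-inverseʳ (d N) (pos⇒≢0 (ℚ.<-≤-trans 0<δ (δ≤∣1+bq^N∣² N 1≤N)))

  e≼G : ∀ N → 1 ≤ N → e N ≼ G
  e≼G N 1≤N = ⁻¹-≼ 0<δ (δ≤∣1+bq^N∣² N 1≤N)

  q^-≼ : ∀ {a k} → a ≤ k → q ^ᴳ k ≼ t ^ℚ a ℚ.* t ^ℚ a
  q^-≼ {a} a≤k = subst (_ ≼_) (^ℚ-distrib-* t t a) (^-≼-antimono (*-nonNeg 0≤t 0≤t) t²≤1 q≼t² a≤k)
    where
    t²≤1 : t ℚ.* t ℚ.≤ 1ℚ
    t²≤1 = ℚ.≤-trans (*-mono-≤ 0≤t 0≤1 t≤1 t≤1) (ℚ.≤-reflexive (ℚ.*-identityˡ 1ℚ))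

  q≼t : q ≼ t
  q≼t = ≼-mono q≼t² (p*p≤p 0≤t t≤1)

  q^-≼′ : ∀ {a k} → a ≤ k → q ^ᴳ k ≼ t ^ℚ a
  q^-≼′ = ^-≼-antimono 0≤t t≤1 q≼t

  ∣1-q^∣²-≥ : ∀ n → (1ℚ ℚ.- t) ℚ.* (1ℚ ℚ.- t) ℚ.≤ norm (𝟏 ⊕ ⊝ q ^ᴳ (m ℕ.* suc n))
  ∣1-q^∣²-≥ n = norm-1⊕ (⊝-≼ (subst (q ^ᴳ (m ℕ.* suc n) ≼_) (ℚ.*-identityʳ t)
    (q^-≼′ (ℕ.>-nonZero⁻¹ (m ℕ.* suc n) {{ℕ.m*n≢0 m (suc n)}})))) t≤1

  0<[1-t]² : 0ℚ ℚ.< (1ℚ ℚ.- t) ℚ.* (1ℚ ℚ.- t)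
  0<[1-t]² = *-pos (0<1-t t<1 0<δ) (0<1-t t<1 0<δ)

  1-q^-inverse : ∀ n → (𝟏 ⊕ ⊝ q ^ᴳ (m ℕ.* suc n)) ⊗ (𝟏 ⊕ ⊝ q ^ᴳ (m ℕ.* suc n)) ⁻¹ ≡ 𝟏
  1-q^-inverse n = ⊗-inverseʳ (𝟏 ⊕ ⊝ q ^ᴳ (m ℕ.* suc n)) (pos⇒≢0 (ℚ.<-≤-trans 0<[1-t]² (∣1-q^∣²-≥ n)))

  Π-≼ : ∀ x l → Π x l ≼ G ^ℚ l
  Π-≼ x zero    = 𝟏≼1
  Π-≼ x (suc l) = ⊗-≼ (e≼G (suc x) (ℕ.s≤s ℕ.z≤n)) (Π-≼ (suc x) l)

  weight-≼ : ∀ {n} s (v : Vec ℕ n) → weight s v ≼ weightBound ^ℚ n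
  weight-≼ s []      = 𝟏≼1
  weight-≼ s (a ∷ v) = ⊗-≼ (Π-≼ (s ℕ.+ a) (suc m)) (weight-≼ (s ℕ.+ suc m) v)

  -- The hypothesis |q| ≤ t² and m ≥ 1 supply two copies of t^(a₁+...+aₙ): outside the listed tuples
  -- one is at most t^k, and the other is summable.
  term-≼ : ∀ {n} s (v : Vec ℕ n) → term s v ≼ t^sum v ℚ.* t^sum v ℚ.* weightBound ^ℚ n
  term-≼ s v = ⊗-≼ (q^-≼ (ℕ.m≤n*m (Vec.sum v) m)) (weight-≼ s v)

  head-factor-≼ : ∀ s a → head-factor s a ≼ t ^ℚ a ℚ.* weightBound
  head-factor-≼ s a = ⊗-≼ (q^-≼′ (ℕ.m≤n*m a m)) (Π-≼ (s ℕ.+ a) (suc m))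

  c-≼ : ∀ n → c n ≼ H ^ℚ n
  c-≼ zero    = 𝟏≼1
  c-≼ (suc n) = subst (c (suc n) ≼_) (ℚ.*-comm (H ^ℚ n) H) (⊗-≼ (c-≼ n) (⁻¹-≼ 0<[1-t]² (∣1-q^∣²-≥ n)))

  -- Decay in A comes from the exponent m(n + 1)A ≥ A; the closed form for empty tuples is
  -- constantly 1.
  closed-≼ : ∀ s n A → closed s (suc n) A ≼ t ^ℚ A ℚ.* closedBound (suc n)
  closed-≼ s n A = subst (closed s (suc n) A ≼_) (ℚ.*-assoc (t ^ℚ A) (H ^ℚ suc n) (G ^ℚ (m ℕ.* suc n)))
    (⊗-≼ (⊗-≼ (q^-≼′ (ℕ.m≤n*m A (m ℕ.* suc n) {{ℕ.m*n≢0 m (suc n)}})) (c-≼ (suc n))) (Π-≼ (s ℕ.+ A) (m ℕ.* suc n)))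

  mutual
    -- For n = 0 sum and closed form both equal 1. For n + 1 the sharper bound below is weakened by
    -- t^A ≤ 1, which leaves a constant independent of s and A for the recursion on n.
    chains-error : ∀ s n A k → ∑ (term s) (chains n A k) ⊕ ⊝ closed s n A ≼ chainsBound n ℚ.* t ^ℚ (A ℕ.+ k)
    chains-error s zero A k = subst₂ _≼_
      (sym (trans (cong₂ (λ z w → z ⊕ ⊝ w) sum≡1 closed≡1) (⊝-inverseʳ 𝟏)))
      (sym (ℚ.*-zeroˡ (t ^ℚ (A ℕ.+ k)))) (𝟎≼ ℚ.≤-refl)
      where
      sum≡1 : ∑ (term s) (chains 0 A k) ≡ 𝟏
      sum≡1 = trans (⊕-identityʳ _) (trans (⊗-identityʳ _) (cong (q ^ᴳ_) (ℕ.*-zeroʳ m)))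

      closed≡1 : closed s 0 A ≡ 𝟏
      closed≡1 = trans (cong (λ k → q ^ᴳ (k ℕ.* A) ⊗ 𝟏 ⊗ Π (s ℕ.+ A) k) (ℕ.*-zeroʳ m))
        (trans (⊗-identityʳ _) (⊗-identityʳ _))
    chains-error s (suc n) A k = ≼-mono (chains-error-suc s n A k) (begin
      t ^ℚ (A ℕ.+ k) ℚ.* (C ℚ.+ D ℚ.* E ℚ.* (h ℚ.* t ^ℚ A))
        ≤⟨ *-monoˡ-≤ (t^-nonNeg (A ℕ.+ k)) (ℚ.+-monoʳ-≤ C (*-monoˡ-≤ (*-nonNeg 0≤D (chainsBound-nonNeg t<1 0<δ n))
             (*-monoˡ-≤ 0≤h (^-≤1 0≤t t≤1 A)))) ⟩
      t ^ℚ (A ℕ.+ k) ℚ.* (C ℚ.+ D ℚ.* E ℚ.* (h ℚ.* 1ℚ))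
        ≡⟨ solve 4 (λ T C x h → T :* (C :+ x :* (h :* con 1ℚ)) := (C :+ x :* h) :* T) refl (t ^ℚ (A ℕ.+ k)) C (D ℚ.* E) h ⟩
      chainsBound (suc n) ℚ.* t ^ℚ (A ℕ.+ k) ∎)
      where
      open ℚ.≤-Reasoning
      C = closedBound (suc n)
      D = weightBound
      E = chainsBound n

    -- The factor t ^ℚ A keeps the sum over the first entry geometric.
    chains-error-suc : ∀ s n A k → ∑ (term s) (chains (suc n) A k) ⊕ ⊝ closed s (suc n) A ≼
      t ^ℚ (A ℕ.+ k) ℚ.* (closedBound (suc n) ℚ.+ weightBound ℚ.* chainsBound n ℚ.* (h ℚ.* t ^ℚ A))
    -- An empty window lists no tuple, so the error is the closed form itself.
    chains-error-suc s n A zero = ≼-mono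
      (subst (_≼ t ^ℚ A ℚ.* closedBound (suc n)) (sym (⊕-identityˡ _)) (⊝-≼ (closed-≼ s n A)))
      (ℚ.≤-trans (*-monoˡ-≤ (t^-nonNeg A) (p≤p+q
          (*-nonNeg (*-nonNeg 0≤D (chainsBound-nonNeg t<1 0<δ n)) (*-nonNeg 0≤h (t^-nonNeg A)))))
        (ℚ.≤-reflexive (cong
          (λ k → t ^ℚ k ℚ.* (closedBound (suc n) ℚ.+ weightBound ℚ.* chainsBound n ℚ.* (h ℚ.* t ^ℚ A)))
          (sym (ℕ.+-identityʳ A)))))
    chains-error-suc s n A (suc k) = subst₂ _≼_ (sym split) bound
      (⊕-≼ (⊗-≼ (head-factor-≼ s A) (chains-error (s ℕ.+ suc m) n A (suc k))) (chains-error-suc s n (suc A) k))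
      where
      u = head-factor s A
      L = chains n A (suc k)
      L′ = chains (suc n) (suc A) k
      C = closedBound (suc n)
      D = weightBound
      E = chainsBound n
      T = t ^ℚ (A ℕ.+ suc k)

      sum-split : ∑ (term s) (chains (suc n) A (suc k)) ≡ u ⊗ ∑ (term (s ℕ.+ suc m)) L ⊕ ∑ (term s) L′
      sum-split = trans (ℚ[i]∑.∑-++ (term s) (List.map (A ∷_) L) L′) (cong (_⊕ ∑ (term s) L′)
        (trans (ℚ[i]∑.∑-map (term s) (A ∷_) L) (trans (ℚ[i]∑.∑-cong (term-∷ s A) L)
          (ℚ[i]∑.*-distribˡ-∑ u (term (s ℕ.+ suc m)) L))))

      split : ∑ (term s) (chains (suc n) A (suc k)) ⊕ ⊝ closed s (suc n) A ≡
        u ⊗ (∑ (term (s ℕ.+ suc m)) L ⊕ ⊝ closed (s ℕ.+ suc m) n A) ⊕ (∑ (term s) L′ ⊕ ⊝ closed s (suc n) (suc A))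
      split = trans (cong₂ (λ z w → z ⊕ ⊝ w) sum-split (closed-telescopes d⊗e 1-q^-inverse s n A))
        (error-split u _ _ _ _)

      -- As (A + 1) + k = A + (k + 1), both errors carry the same power T; `h-step` then merges t^A
      -- with t^(A+1) h.
      bound : t ^ℚ A ℚ.* D ℚ.* (E ℚ.* T) ℚ.+ t ^ℚ (suc A ℕ.+ k) ℚ.* (C ℚ.+ D ℚ.* E ℚ.* (h ℚ.* t ^ℚ suc A)) ≡
        T ℚ.* (C ℚ.+ D ℚ.* E ℚ.* (h ℚ.* t ^ℚ A))
      bound = trans
        (cong (λ j → t ^ℚ A ℚ.* D ℚ.* (E ℚ.* T) ℚ.+ t ^ℚ j ℚ.* (C ℚ.+ D ℚ.* E ℚ.* (h ℚ.* t ^ℚ suc A))) (sym (ℕ.+-suc A k)))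
        (trans (solve 7 (λ t h a C D E T →
            a :* D :* (E :* T) :+ T :* (C :+ D :* E :* (h :* (t :* a))) := T :* (C :+ D :* E :* (a :+ t :* a :* h)))
            refl t h (t ^ℚ A) C D E T)
          (cong (λ z → T ℚ.* (C ℚ.+ D ℚ.* E ℚ.* z)) (trans (h-step (t ^ℚ A)) (ℚ.*-comm (t ^ℚ A) h))))

  tail-≼ : ∀ {n} k (R : List (Vec ℕ n)) → Unique R → All (λ v → Linked _≤_ (0 ∷ v)) R →
    All (λ v → k ≤ Vec.sum v) R → ∑ (term 0) R ≼ weightBound ^ℚ n ℚ.* h ^ℚ n ℚ.* t ^ℚ k
  tail-≼ {n} k R u linked large = ≼-mono (∑-≼ (All.map (λ {v} → bound v) large)) (begin
    ∑ℚ (λ v → Dⁿ ℚ.* t ^ℚ k ℚ.* t^sum v) R   ≡⟨ ℚ∑.*-distribˡ-∑ (Dⁿ ℚ.* t ^ℚ k) t^sum R ⟩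
    Dⁿ ℚ.* t ^ℚ k ℚ.* ∑ℚ t^sum R             ≤⟨ *-monoˡ-≤ (*-nonNeg 0≤Dⁿ (t^-nonNeg k)) (∑-linked R u linked) ⟩
    Dⁿ ℚ.* t ^ℚ k ℚ.* h ^ℚ n                 ≡⟨ solve 3 (λ D T h → D :* T :* h := D :* h :* T) refl Dⁿ (t ^ℚ k) (h ^ℚ n) ⟩
    Dⁿ ℚ.* h ^ℚ n ℚ.* t ^ℚ k                 ∎)
    where
    open ℚ.≤-Reasoning
    Dⁿ = weightBound ^ℚ n
    0≤Dⁿ = ^-nonNeg 0≤D n

    bound : ∀ v → k ≤ Vec.sum v → term 0 v ≼ Dⁿ ℚ.* t ^ℚ k ℚ.* t^sum v
    bound v k≤ = ≼-mono (term-≼ 0 v) (ℚ.≤-trans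
      (*-monoʳ-≤ 0≤Dⁿ (*-monoʳ-≤ (t^-nonNeg (Vec.sum v)) (^-antimono-≤ 0≤t t≤1 k≤)))
      (ℚ.≤-reflexive (solve 3 (λ T x D → T :* x :* D := D :* T :* x) refl (t ^ℚ k) (t^sum v) Dⁿ)))

  -- Up to permutation W consists of the listed tuples and a remainder R. By uniqueness no member of
  -- R is listed, so its entries sum to at least k and `tail-≼` applies.
  estimate : ∀ {n} k (W : List (Vec ℕ n)) → Unique W → All (λ v → Linked _≤_ (0 ∷ v)) W → chains n 0 k ⊆ W →
    ∑ (term 0) W ⊕ ⊝ closed 0 n 0 ≼ totalBound n ℚ.* t ^ℚ k
  estimate {n} k W u linked chains⊆W =
    let R , W↭ = ⊆⇒↭-++ (chains-unique n 0 k) chains⊆W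
        uR , disj = Unique-++⁻ (chains n 0 k) (↭ₛ.Unique-resp-↭ (setoid (Vec ℕ n)) (↭⇒↭ₛ W↭) u)
        linkedR = All.++⁻ʳ (chains n 0 k) (All-resp-↭ W↭ linked)
        largeR = All.tabulate λ {v} v∈R → large v (All.lookup linkedR v∈R) λ v∈ → disj (v∈ , v∈R)
    in subst₂ _≼_
      (sym (trans (cong (_⊕ ⊝ closed 0 n 0) (trans (ℚ[i]∑.∑-↭ (term 0) W↭) (ℚ[i]∑.∑-++ (term 0) (chains n 0 k) R)))
        (error-+ (∑ (term 0) (chains n 0 k)) (∑ (term 0) R) (closed 0 n 0))))
      (sym (ℚ.*-distribʳ-+ (t ^ℚ k) (chainsBound n) (weightBound ^ℚ n ℚ.* h ^ℚ n)))
      (⊕-≼ (chains-error 0 n 0 k) (tail-≼ k R uR linkedR largeR))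
    where
    large : ∀ v → Linked _≤_ (0 ∷ v) → (v ∈ chains n 0 k → _) → k ≤ Vec.sum v
    large v l v∉ with chains-complete 0 k v l
    ... | inj₁ v∈ = contradiction v∈ v∉
    ... | inj₂ k≤ = k≤

-- Passage to real Cauchy sequences

infix 10 _⟨_⟩

_⟨_⟩ : ℂ → ℕ → ℚ[i]
z ⟨ i ⟩ = seq (re z) i , seq (im z) i

opaque
  unfolding _⊗_

  +-⟨⟩ : ∀ z w i → (z + w) ⟨ i ⟩ ≡ z ⟨ i ⟩ ⊕ w ⟨ i ⟩
  +-⟨⟩ z w i = refl

  *-⟨⟩ : ∀ z w i → (z * w) ⟨ i ⟩ ≡ z ⟨ i ⟩ ⊗ w ⟨ i ⟩
  *-⟨⟩ z w i = refl

  neg-⟨⟩ : ∀ z i → (- z) ⟨ i ⟩ ≡ ⊝ z ⟨ i ⟩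
  neg-⟨⟩ z i = refl

  1-⟨⟩ : ∀ i → 1ℂ ⟨ i ⟩ ≡ 𝟏
  1-⟨⟩ i = refl

  -- Valid even at early indices where the norm vanishes, since both sides use `inv` with its value
  -- 0 at 0.
  inverse-⟨⟩ : ∀ z z#0 i → inverse z z#0 ⟨ i ⟩ ≡ z ⟨ i ⟩ ⁻¹
  inverse-⟨⟩ z z#0 i = refl

  normSq-⟨⟩ : ∀ z i → seq (normSq z) i ≡ norm (z ⟨ i ⟩)
  normSq-⟨⟩ z i = refl

  sumOver-⟨⟩ : ∀ {I : Set} (f : I → ℂ) F i → sumOver f F ⟨ i ⟩ ≡ ∑ (λ x → f x ⟨ i ⟩) F
  sumOver-⟨⟩ f []      i = refl
  sumOver-⟨⟩ f (x ∷ F) i = cong (f x ⟨ i ⟩ ⊕_) (sumOver-⟨⟩ f F i)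

  norm-components : ∀ x y → norm (x , y) ≡ x ℚ.* x ℚ.+ y ℚ.* y
  norm-components x y = refl

^-⟨⟩ : ∀ z n i → (z ^ n) ⟨ i ⟩ ≡ z ⟨ i ⟩ ^ᴳ n
^-⟨⟩ z zero    i = 1-⟨⟩ i
^-⟨⟩ z (suc n) i = trans (*-⟨⟩ z (z ^ n) i) (cong (z ⟨ i ⟩ ⊗_) (^-⟨⟩ z n i))

product-⟨⟩ : ∀ n (f : Fin n → ℂ) {g : Fin n → ℚ[i]} i →
  (∀ j → f j ⟨ i ⟩ ≡ g j) → product {n} f ⟨ i ⟩ ≡ ∏ {n} g
product-⟨⟩ zero    f i f≗g = 1-⟨⟩ i
product-⟨⟩ (suc n) f i f≗g = trans (*-⟨⟩ (f Fin.zero) (product {n} (λ j → f (Fin.suc j))) i)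
  (cong₂ _⊗_ (f≗g Fin.zero) (product-⟨⟩ n (λ j → f (Fin.suc j)) i (λ j → f≗g (Fin.suc j))))

1+bq^-⟨⟩ : ∀ b q N i → (1ℂ + b * q ^ N) ⟨ i ⟩ ≡ 𝟏 ⊕ b ⟨ i ⟩ ⊗ q ⟨ i ⟩ ^ᴳ N
1+bq^-⟨⟩ b q N i = trans (+-⟨⟩ 1ℂ (b * q ^ N) i) (cong₂ _⊕_ (1-⟨⟩ i)
  (trans (*-⟨⟩ b (q ^ N) i) (cong (b ⟨ i ⟩ ⊗_) (^-⟨⟩ q N i))))

qPochhammer-⟨⟩ : ∀ x q n i {X Q} → x ⟨ i ⟩ ≡ X → q ⟨ i ⟩ ≡ Q →
  qPochhammer x q n ⟨ i ⟩ ≡ ∏ {n} (λ j → 𝟏 ⊕ ⊝ (X ⊗ Q ^ᴳ toℕ j))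
qPochhammer-⟨⟩ x q n i refl refl = product-⟨⟩ n (λ j → 1ℂ - x * q ^ toℕ j) i λ j →
  trans (+-⟨⟩ 1ℂ (- (x * q ^ toℕ j)) i) (cong₂ _⊕_ (1-⟨⟩ i)
    (trans (neg-⟨⟩ (x * q ^ toℕ j) i) (cong ⊝_
      (trans (*-⟨⟩ x (q ^ toℕ j) i) (cong (x ⟨ i ⟩ ⊗_) (^-⟨⟩ q (toℕ j) i))))))

-- Bounds valid for all large indices

Eventually : (ℕ → Set) → Set
Eventually P = ∃[ N ] (∀ i → N ≤ i → P i)

eventually-map : ∀ {P Q : ℕ → Set} → (∀ i → P i → Q i) → Eventually P → Eventually Q
eventually-map f (N , p) = N , λ i N≤i → f i (p i N≤i)

eventually-× : ∀ {P Q : ℕ → Set} → Eventually P → Eventually Q → Eventually (λ i → P i × Q i)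
eventually-× (M , p) (N , q) = M ℕ.⊔ N , λ i M⊔N≤i →
  p i (ℕ.m⊔n≤o⇒m≤o M N M⊔N≤i) , q i (ℕ.m⊔n≤o⇒n≤o M N M⊔N≤i)

mean<1 : ∀ {p} → p ℚ.< 1ℚ → ½ ℚ.* (1ℚ ℚ.+ p) ℚ.< 1ℚ
mean<1 p<1 = ℚ.*-monoʳ-<-pos ½ (ℚ.+-monoʳ-< 1ℚ p<1)

mean-nonNeg : ∀ {p} → 0ℚ ℚ.≤ p → 0ℚ ℚ.≤ ½ ℚ.* (1ℚ ℚ.+ p)
mean-nonNeg 0≤p = *-nonNeg (ℚ.<⇒≤ 0<½) (+-nonNeg 0≤1 0≤p)

-- From |q|² ≤ s < 1, taking the mean with 1 twice gives s ≤ r² and r ≤ t², hence |q| ≤ r ≤ t² with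
-- t still below 1.
disc-bound : ∀ q → ∣ q ∣< 1ℝ →
  Σ[ t ∈ ℚ ] 0ℚ ℚ.≤ t × t ℚ.< 1ℚ × Eventually (λ i → q ⟨ i ⟩ ≼ t ℚ.* t)
disc-bound q (_ , δ , 0<δ , N , |q|²+δ≤1) =
  t , mean-nonNeg 0≤r , mean<1 (mean<1 s<1) , N , λ i N≤i →
    ≼-mono (0≤r , ℚ.≤-trans (norm≤s i N≤i) (AM-GM s)) (AM-GM r)
  where
  s = 1ℚ ℚ.- δ
  r = ½ ℚ.* (1ℚ ℚ.+ s)
  t = ½ ℚ.* (1ℚ ℚ.+ r)

  norm≤s : ∀ i → N ≤ i → norm (q ⟨ i ⟩) ℚ.≤ s
  norm≤s i N≤i = subst (ℚ._≤ s)
    (solve 2 (λ x δ → x :+ δ :- δ := x) refl (norm (q ⟨ i ⟩)) δ)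
    (ℚ.+-monoˡ-≤ (ℚ.- δ) (subst (λ x → x ℚ.+ δ ℚ.≤ 1ℚ) (normSq-⟨⟩ q i) (|q|²+δ≤1 i N≤i)))

  s<1 : s ℚ.< 1ℚ
  s<1 = subst (s ℚ.<_) (ℚ.+-identityʳ 1ℚ) (ℚ.+-monoʳ-< 1ℚ (ℚ.neg-antimono-< 0<δ))

  -- s is nonnegative because it bounds a norm at index N.
  0≤r = mean-nonNeg (ℚ.≤-trans (norm-nonNeg (q ⟨ N ⟩)) (norm≤s N ℕ.≤-refl))

ℝ-bounded : ∀ x → ∃[ X ] Eventually (λ i → ℚ.∣ seq x i ∣ ℚ.≤ X)
ℝ-bounded x = let N , close = cauchy x 1ℚ (ℚ.positive⁻¹ 1ℚ) in
  ℚ.∣ seq x N ∣ ℚ.+ 1ℚ , N , λ i N≤i → ℚ.≤-trans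
    (ℚ.≤-reflexive (cong ℚ.∣_∣ (solve 2 (λ x y → y := x :+ (y :- x)) refl (seq x N) (seq x i))))
    (ℚ.≤-trans (ℚ.∣p+q∣≤∣p∣+∣q∣ (seq x N) (seq x i ℚ.- seq x N))
      (ℚ.+-monoʳ-≤ ℚ.∣ seq x N ∣ (ℚ.<⇒≤ (close i N N≤i ℕ.≤-refl))))

ℂ-bounded : ∀ z → ∃[ B ] Eventually (λ i → z ⟨ i ⟩ ≼ B)
ℂ-bounded z =
  let X , |x|≤X = ℝ-bounded (re z)
      Y , |y|≤Y = ℝ-bounded (im z)
  in X ℚ.+ Y , eventually-map (λ i (x≤ , y≤) → bound (seq (re z) i) (seq (im z) i) x≤ y≤) (eventually-× |x|≤X |y|≤Y)
  where
  open ℚ.≤-Reasoning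
  square-≤ : ∀ x {X} → ℚ.∣ x ∣ ℚ.≤ X → x ℚ.* x ℚ.≤ X ℚ.* X
  square-≤ x {X} |x|≤X = begin
    x ℚ.* x                ≡⟨ ℚ.0≤p⇒∣p∣≡p (square-nonNeg x) ⟨
    ℚ.∣ x ℚ.* x ∣           ≡⟨ ℚ.∣p*q∣≡∣p∣*∣q∣ x x ⟩
    ℚ.∣ x ∣ ℚ.* ℚ.∣ x ∣       ≤⟨ *-mono-≤ (ℚ.0≤∣p∣ x) (ℚ.≤-trans (ℚ.0≤∣p∣ x) |x|≤X) |x|≤X |x|≤X ⟩
    X ℚ.* X                ∎

  bound : ∀ x y {X Y} → ℚ.∣ x ∣ ℚ.≤ X → ℚ.∣ y ∣ ℚ.≤ Y → (x , y) ≼ X ℚ.+ Y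
  bound x y {X} {Y} |x|≤X |y|≤Y = +-nonNeg 0≤X 0≤Y , (begin
    norm (x , y)                                    ≡⟨ norm-components x y ⟩
    x ℚ.* x ℚ.+ y ℚ.* y                             ≤⟨ ℚ.+-mono-≤ (square-≤ x |x|≤X) (square-≤ y |y|≤Y) ⟩
    X ℚ.* X ℚ.+ Y ℚ.* Y                             ≤⟨ p≤p+q (+-nonNeg (*-nonNeg 0≤X 0≤Y) (*-nonNeg 0≤X 0≤Y)) ⟩
    X ℚ.* X ℚ.+ Y ℚ.* Y ℚ.+ (X ℚ.* Y ℚ.+ X ℚ.* Y)
      ≡⟨ solve 2 (λ X Y → X :* X :+ Y :* Y :+ (X :* Y :+ X :* Y) := (X :+ Y) :* (X :+ Y)) refl X Y ⟩
    (X ℚ.+ Y) ℚ.* (X ℚ.+ Y)                         ∎)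
    where
    0≤X = ℚ.≤-trans (ℚ.0≤∣p∣ x) |x|≤X
    0≤Y = ℚ.≤-trans (ℚ.0≤∣p∣ y) |y|≤Y

common-lower-bound : ∀ {p q} → 0ℚ ℚ.< p → 0ℚ ℚ.< q → Σ[ r ∈ ℚ ] 0ℚ ℚ.< r × r ℚ.≤ p × r ℚ.≤ q
common-lower-bound {p} {q} 0<p 0<q with ℚ.≤-total p q
... | inj₁ p≤q = p , 0<p , ℚ.≤-refl , p≤q
... | inj₂ q≤p = q , 0<q , q≤p , ℚ.≤-refl

-- The minimum of finitely many positive bounds works from the latest of their starting indices on.
-- The cases K = 0 and K = 1 are vacuous.
apart-finitely : ∀ (z : ℕ → ℂ) → (∀ N → 1 ≤ N → z N #0) → ∀ K →
  Σ[ δ ∈ ℚ ] 0ℚ ℚ.< δ × Eventually (λ i → ∀ N → 1 ≤ N → N ℕ.< K → δ ℚ.≤ norm (z N ⟨ i ⟩))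
apart-finitely z z#0 zero          = 1ℚ , ℚ.positive⁻¹ 1ℚ , 0 , λ _ _ _ _ ()
apart-finitely z z#0 (suc zero)    = 1ℚ , ℚ.positive⁻¹ 1ℚ , 0 , λ { _ _ (suc _) _ (ℕ.s≤s ()) }
apart-finitely z z#0 (suc (suc K)) =
  let δ , 0<δ , below = apart-finitely z z#0 (suc K)
      δ′ , 0<δ′ , M , δ′≤ = z#0 (suc K) (ℕ.s≤s ℕ.z≤n)
      r , 0<r , r≤δ , r≤δ′ = common-lower-bound 0<δ 0<δ′
  in r , 0<r , eventually-map (λ i (low , new) N 1≤N N<2+K → case i r≤δ r≤δ′ low new N 1≤N N<2+K)
       (eventually-× below (M , λ i M≤i → subst₂ ℚ._≤_ (ℚ.+-identityˡ δ′) (normSq-⟨⟩ (z (suc K)) i) (δ′≤ i M≤i)))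
  where
  case : ∀ {r δ δ′} i → r ℚ.≤ δ → r ℚ.≤ δ′ →
    (∀ N → 1 ≤ N → N ℕ.< suc K → δ ℚ.≤ norm (z N ⟨ i ⟩)) → δ′ ℚ.≤ norm (z (suc K) ⟨ i ⟩) →
    ∀ N → 1 ≤ N → N ℕ.< suc (suc K) → r ℚ.≤ norm (z N ⟨ i ⟩)
  case i r≤δ r≤δ′ low new N 1≤N (ℕ.s≤s N≤1+K) with ℕ.m≤n⇒m<n∨m≡n N≤1+K
  ... | inj₁ N<1+K = ℚ.≤-trans r≤δ (low N 1≤N N<1+K)
  ... | inj₂ refl  = ℚ.≤-trans r≤δ′ new

-- The hypothesis bounds each 1 + b q^N away from 0 separately. Once B t^K ≤ ½, every N ≥ K has |b
-- q^N| ≤ ½ and hence squared modulus at least ¼, so only finitely many N need their own bound.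
apart-uniformly : ∀ {q b t} → 0ℚ ℚ.≤ t → t ℚ.< 1ℚ → Eventually (λ i → q ⟨ i ⟩ ≼ t ℚ.* t) → NoPole q b →
  Σ[ δ ∈ ℚ ] 0ℚ ℚ.< δ × Eventually (λ i → ∀ N → 1 ≤ N → δ ℚ.≤ norm (𝟏 ⊕ b ⟨ i ⟩ ⊗ q ⟨ i ⟩ ^ᴳ N))
apart-uniformly {q} {b} {t} 0≤t t<1 q≼t² b≠ =
  let B , b≼B = ℂ-bounded b
      0≤B = nonNeg (proj₂ b≼B (proj₁ b≼B) ℕ.≤-refl)
      K , Bt^K≤½ = ^-null 0≤t t<1 0≤B 0<½
      δ , 0<δ , low = apart-finitely (λ N → 1ℂ + b * q ^ N) b≠ K
      r , 0<r , r≤δ , r≤¼ = common-lower-bound 0<δ (*-pos 0<½ 0<½)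
  in r , 0<r , eventually-map (λ i ((q≼ , b≼) , low-i) N 1≤N → case i K Bt^K≤½ r≤δ r≤¼ q≼ b≼ low-i N 1≤N)
       (eventually-× (eventually-× q≼t² b≼B) low)
  where
  case : ∀ {r δ B} i K → B ℚ.* t ^ℚ K ℚ.≤ ½ → r ℚ.≤ δ → r ℚ.≤ ½ ℚ.* ½ → q ⟨ i ⟩ ≼ t ℚ.* t → b ⟨ i ⟩ ≼ B →
    (∀ N → 1 ≤ N → N ℕ.< K → δ ℚ.≤ norm ((1ℂ + b * q ^ N) ⟨ i ⟩)) →
    ∀ N → 1 ≤ N → r ℚ.≤ norm (𝟏 ⊕ b ⟨ i ⟩ ⊗ q ⟨ i ⟩ ^ᴳ N)
  case {r} i K Bt^K≤½ r≤δ r≤¼ q≼ b≼ low N 1≤N with N ℕ.<? K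
  ... | yes N<K = subst (λ z → r ℚ.≤ norm z) (1+bq^-⟨⟩ b q N i) (ℚ.≤-trans r≤δ (low N 1≤N N<K))
  ... | no  N≮K = ℚ.≤-trans r≤¼ (norm-1⊕
    (≼-mono (⊗-≼ b≼ (^-≼-antimono 0≤t (ℚ.<⇒≤ t<1) (≼-mono q≼ (p*p≤p 0≤t (ℚ.<⇒≤ t<1))) (ℕ.≮⇒≥ N≮K))) Bt^K≤½) ½≤1)

-- Convergence of the sum

Linked-0∷ : ∀ {n} (a : WeaklyIncreasing n) → Linked _≤_ (0 ∷ proj₁ a)
Linked-0∷ ([]    , l) = [-]
Linked-0∷ (_ ∷ _ , l) = ℕ.z≤n ∷ l

-- Proofs of monotonicity are unique, so distinct indices have distinct tuples.
proj₁-injective : ∀ {n} {a a′ : WeaklyIncreasing n} → proj₁ a ≡ proj₁ a′ → a ≡ a′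
proj₁-injective {a = a , l} {.a , l′} refl = cong (a ,_) (Linked.irrelevant ℕ.≤-irrelevant l l′)

lift-All : ∀ {A : Set} {P : A → Set} {xs} → All P xs → Σ[ F ∈ List (Σ A P) ] List.map proj₁ F ≡ xs
lift-All []         = [] , refl
lift-All (px ∷ pxs) = let F , eq = lift-All pxs in (_ , px) ∷ F , cong (_ ∷_) eq

-- The strict inequality requires a fixed rational gap. With ε ≥ η eventually and |z| ≤ η/2, the gap
-- δ = (η/2)² works: |z|² + δ ≤ 2δ ≤ 4δ = η² ≤ ε².
∣∣<-intro : ∀ z ε (0<ε : 0ℝ <ᴿ ε) → Eventually (λ i → z ⟨ i ⟩ ≼ ½ ℚ.* proj₁ 0<ε) → ∣ z ∣< ε
∣∣<-intro z ε 0<ε@(η , 0<η , M , 0+η≤ε) z≼ =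
  let N , bound = eventually-× z≼ (M , 0+η≤ε) in
  0<ε , δ , *-pos 0<½η 0<½η , N , λ i N≤i →
    let z≼½η , 0+η≤εᵢ = bound i N≤i
        η≤εᵢ = subst (ℚ._≤ seq ε i) (ℚ.+-identityˡ η) 0+η≤εᵢ
    in begin
      seq (normSq z) i ℚ.+ δ    ≡⟨ cong (ℚ._+ δ) (normSq-⟨⟩ z i) ⟩
      norm (z ⟨ i ⟩) ℚ.+ δ      ≤⟨ ℚ.+-monoˡ-≤ δ (bounded z≼½η) ⟩
      δ ℚ.+ δ                   ≤⟨ p≤p+q (+-nonNeg (square-nonNeg (½ ℚ.* η)) (square-nonNeg (½ ℚ.* η))) ⟩
      δ ℚ.+ δ ℚ.+ (δ ℚ.+ δ)     ≡⟨ solve 1 (λ η →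
        let δ = (con ½ :* η) :* (con ½ :* η) in δ :+ δ :+ (δ :+ δ) := η :* η) refl η ⟩
      η ℚ.* η                   ≤⟨ *-mono-≤ (ℚ.<⇒≤ 0<η) (ℚ.≤-trans (ℚ.<⇒≤ 0<η) η≤εᵢ) η≤εᵢ η≤εᵢ ⟩
      seq ε i ℚ.* seq ε i       ∎
  where
  open ℚ.≤-Reasoning
  0<½η = *-pos 0<½ 0<η
  δ = (½ ℚ.* η) ℚ.* (½ ℚ.* η)

summand-⟨⟩ : ∀ q b m {n} (a : Vec ℕ n) (den#0 : denominator q b m a #0) i →
  (q ^ (m ℕ.* Vec.sum a) / denominator q b m a ∵ den#0) ⟨ i ⟩ ≡
  q ⟨ i ⟩ ^ᴳ (m ℕ.* Vec.sum a) ⊗ (∏ {n} λ j → ∏ {suc m} λ k →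
    𝟏 ⊕ b ⟨ i ⟩ ⊗ q ⟨ i ⟩ ^ᴳ (toℕ j ℕ.* suc m ℕ.+ suc (toℕ k) ℕ.+ Vec.lookup a j)) ⁻¹
summand-⟨⟩ q b m {n} a den#0 i = trans (*-⟨⟩ (q ^ (m ℕ.* Vec.sum a)) (inverse (denominator q b m a) den#0) i)
  (cong₂ _⊗_ (^-⟨⟩ q (m ℕ.* Vec.sum a) i) (trans (inverse-⟨⟩ (denominator q b m a) den#0 i) (cong _⁻¹
    (product-⟨⟩ n (λ j → product {suc m} (factor j)) i λ j → product-⟨⟩ (suc m) (factor j) i λ k →
      1+bq^-⟨⟩ b q (toℕ j ℕ.* suc m ℕ.+ suc (toℕ k) ℕ.+ Vec.lookup a j) i))))
  where
  factor : Fin n → Fin (suc m) → ℂ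
  factor j k = 1ℂ + b * q ^ (toℕ j ℕ.* suc m ℕ.+ suc (toℕ k) ℕ.+ Vec.lookup a j)

value-⟨⟩ : ∀ q b m n (den#0 : qPochhammer (q ^ m) (q ^ m) n * qPochhammer (- (b * q)) q (m ℕ.* n) #0) i →
  (1ℂ / qPochhammer (q ^ m) (q ^ m) n * qPochhammer (- (b * q)) q (m ℕ.* n) ∵ den#0) ⟨ i ⟩ ≡
  𝟏 ⊗ (∏ {n} (λ j → 𝟏 ⊕ ⊝ (q ⟨ i ⟩ ^ᴳ m ⊗ (q ⟨ i ⟩ ^ᴳ m) ^ᴳ toℕ j)) ⊗
       ∏ {m ℕ.* n} (λ j → 𝟏 ⊕ ⊝ (⊝ (b ⟨ i ⟩ ⊗ q ⟨ i ⟩) ⊗ q ⟨ i ⟩ ^ᴳ toℕ j))) ⁻¹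
value-⟨⟩ q b m n den#0 i = trans (*-⟨⟩ 1ℂ (inverse (P * P′) den#0) i) (cong₂ _⊗_ (1-⟨⟩ i)
  (trans (inverse-⟨⟩ (P * P′) den#0 i) (cong _⁻¹ (trans (*-⟨⟩ P P′ i) (cong₂ _⊗_
    (qPochhammer-⟨⟩ (q ^ m) (q ^ m) n i (^-⟨⟩ q m i) (^-⟨⟩ q m i))
    (qPochhammer-⟨⟩ (- (b * q)) q (m ℕ.* n) i (trans (neg-⟨⟩ (b * q) i) (cong ⊝_ (*-⟨⟩ b q i))) refl))))))
  where
  P  = qPochhammer (q ^ m) (q ^ m) n
  P′ = qPochhammer (- (b * q)) q (m ℕ.* n)

lemma3 : (q b : ℂ) (∣q∣<1 : ∣ q ∣< 1ℝ)
    (b≠ : ∀ N → 1 ≤ N → 1ℂ + b * q ^ N #0)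
    (m n : ℕ) .{{_ : NonZero m}} .{{_ : NonZero n}} →
    HasSum {WeaklyIncreasing n}
    (λ s → let a = proj₁ s in
    q ^ (m ℕ.* Vec.sum a) / denominator q b m a
    ∵ denominator-#0 q b b≠ m a)
    (1ℂ / qPochhammer (q ^ m) (q ^ m) n * qPochhammer (- (b * q)) q (m ℕ.* n)
    ∵ *-#0 (qPochhammer (q ^ m) (q ^ m) n) (qPochhammer (- (b * q)) q (m ℕ.* n))
    (qPochhammer-q^m-#0 q ∣q∣<1 m n)
    (qPochhammer-bq-#0 q b b≠ (m ℕ.* n)))
lemma3 q b ∣q∣<1 b≠ m n ε 0<ε@(η , 0<η , _) =
  let t , 0≤t , t<1 , q≼t² = disc-bound q ∣q∣<1
      δ , 0<δ , δ≤ = apart-uniformly {q} {b} 0≤t t<1 q≼t² b≠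
      open Constants m t δ
      -- `totalBound n` depends only on t, δ, m and n, so one k serves all large i and every finite
      -- F.
      k , small = ^-null 0≤t t<1 (totalBound-nonNeg t<1 0<δ n) (*-pos 0<½ 0<η)
      -- The index type carries monotonicity proofs: they are recovered from `chains-linked` by
      -- dropping the leading 0.
      F₀ , F₀≡chains = lift-All (All.map Linked.tail (chains-linked n 0 k))
  in F₀ , λ F unique F₀⊆F → ∣∣<-intro (sumOver f F - S) ε 0<ε
    (eventually-map (λ i (q≼t²ᵢ , δ≤ᵢ) →
      let open Estimate m (q ⟨ i ⟩) (b ⟨ i ⟩) 0≤t t<1 q≼t²ᵢ 0<δ δ≤ᵢ
          open Series m (q ⟨ i ⟩) (b ⟨ i ⟩)
          -- At a fixed index the quotients are exact Gaussian rationals, so summands and claimed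
          -- value can be rewritten as `term` and `closed`.
          summand≡term = λ a → trans (summand-⟨⟩ q b m (proj₁ a) (denominator-#0 q b b≠ m (proj₁ a)) i)
            (term-value d⊗e 1-q^-inverse (proj₁ a))
          S≡closed = trans (value-⟨⟩ q b m n S#0 i) (closed-value d⊗e 1-q^-inverse n)
          sum≡∑term = trans (sumOver-⟨⟩ f F i)
            (trans (ℚ[i]∑.∑-cong summand≡term F) (sym (ℚ[i]∑.∑-map (term 0) proj₁ F)))
      in ≼-mono (subst (_≼ totalBound n ℚ.* t ^ℚ k)
        (sym (trans (+-⟨⟩ (sumOver f F) (- S) i) (cong₂ _⊕_ sum≡∑term (trans (neg-⟨⟩ S i) (cong ⊝_ S≡closed)))))
        (estimate k (List.map proj₁ F) (Unique.map⁺ proj₁-injective unique)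
          (All.map⁺ (All.universal Linked-0∷ F))
          (subst (_⊆ List.map proj₁ F) F₀≡chains (⊆.map⁺ proj₁ F₀⊆F))))
        small)
      (eventually-× q≼t² δ≤))
  where
  f : WeaklyIncreasing n → ℂ
  f s = q ^ (m ℕ.* Vec.sum (proj₁ s)) / denominator q b m (proj₁ s) ∵ denominator-#0 q b b≠ m (proj₁ s)

  S#0 : qPochhammer (q ^ m) (q ^ m) n * qPochhammer (- (b * q)) q (m ℕ.* n) #0
  S#0 = *-#0 (qPochhammer (q ^ m) (q ^ m) n) (qPochhammer (- (b * q)) q (m ℕ.* n))
    (qPochhammer-q^m-#0 q ∣q∣<1 m n) (qPochhammer-bq-#0 q b b≠ (m ℕ.* n))

  S : ℂ
  S = 1ℂ / qPochhammer (q ^ m) (q ^ m) n * qPochhammer (- (b * q)) q (m ℕ.* n) ∵ S#0
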